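{- Let $t\ge 1$, $k\geq t+2$ and let $\mathcal{F}$ be a $t$-intersecting family of $k$-partitions of $[n]$. If $n\geq t+1+(k-t-1)\log_2(2ek+1)$, then $$|\mathcal{F}|\leq S(n-t,k-t).$$ Moreover, equality holds precisely if $\mathcal{F}$ consists of all $k$-partitions of $[n]$ having $t$ fixed singletons as blocks.
   Context: $[n]=\{1,\dots,n\}$ and $e$ is the base of the natural logarithm. A $k$-partition of $[n]$ is a collection of $k$ pairwise disjoint non-empty subsets (blocks) of $[n]$ whose union is $[n]$. A family of $k$-partitions of $[n]$ is $t$-intersecting if any two of its members share at least $t$ blocks. $S(m,j)$ denotes the Stirling number of the second kind, i.e. the number of $j$-partitions of $[m]$; thus $S(n-t,k-t)=\frac{1}{(k-t)!}\sum_{j=0}^{k-t}(-1)^j\binom{k-t}{j}(k-t-j)^{n-t}$. -}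

module Defs where

import Algebra.Definitions.RawSemiring
open import Data.Bool.Properties using () renaming (_≟_ to _≟ᵇ_)
open import Data.Fin.Subset using (Subset; inside; outside; Nonempty; Empty; _∩_; ⋃; ⊤; ⁅_⁆; ∣_∣)
import Data.Fin.Subset as Sub
open import Data.Fin.Subset.Properties using (nonempty?)
open import Data.Integer using (ℤ; +_; -[1+_])
open import Data.List using (List; []; _∷_; [_]; _++_; map; length; filter)
import Data.List.Membership.DecPropositional as DecMembership
import Data.List.Membership.Setoid as SetoidMembership
open import Data.List.Relation.Binary.Permutation.Propositional using (↭-setoid)
open import Data.List.Relation.Unary.All using (All; all?)
open import Data.List.Relation.Unary.AllPairs using (AllPairs; allPairs?)
import Data.List.Relation.Unary.Unique.Setoid as SetoidUnique
open import Data.Nat using (ℕ; zero; suc; _!)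
import Data.Nat as ℕ
open import Data.Nat.Properties using (_!≢0; m^n≢0)
open import Data.Product using (Σ; _×_; ∃; ∃₂; proj₁)
open import Data.Rational.Unnormalised using (ℚᵘ; 0ℚᵘ; 1ℚᵘ; _/_; _+_; _≤_; _<_; ↥_; ↧ₙ_; +-*-rawSemiring)
import Data.Vec as Vec
import Data.Vec.Properties as Vec
open import Function.Bundles using (_⇔_)
open import Level using (0ℓ)
open import Relation.Binary using (Setoid; DecidableEquality)
import Relation.Binary.Construct.On as On
open import Relation.Binary.PropositionalEquality using (_≡_)
open import Relation.Nullary using (Dec; ¬?)
open import Relation.Nullary.Decidable using (_×-dec_)

open Algebra.Definitions.RawSemiring +-*-rawSemiring using (_^_)

-- The real number x is represented by its open lower cut { q | q < x }.
-- Only sums, natural multiples, e, base-2 logarithms and the order are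
-- needed, and all of these are determined by lower cuts.
ℝ : Set₁
ℝ = ℚᵘ → Set

infix  4 _≥ℝ_
infixl 6 _+ℝ_
infixr 7 _·_

_≥ℝ_ : ℝ → ℝ → Set
x ≥ℝ y = ∀ q → y q → x q

fromℕ : ℕ → ℝ
fromℕ n q = q < + n / 1

_+ℝ_ : ℝ → ℝ → ℝ
(x +ℝ y) q = ∃₂ λ a b → x a × y b × q ≤ a + b

_·_ : ℕ → ℝ → ℝ
zero  · x = fromℕ 0
suc m · x = x +ℝ m · x

-- 1/0! + 1/1! + ⋯ + 1/m!
expSum : ℕ → ℚᵘ
expSum zero    = 1ℚᵘ
expSum (suc m) = expSum m + _/_ (+ 1) (suc m !) {{suc m !≢0}}

-- e is the supremum of the increasing sequence expSum.
e : ℝ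
e q = ∃ λ m → q < expSum m

2^_ : ℤ → ℚᵘ
2^ (+ m)    = + (2 ℕ.^ m) / 1
2^ -[1+ m ] = _/_ (+ 1) (2 ℕ.^ suc m) {{m^n≢0 2 (suc m)}}

-- For x > 0 and q = a / b with b > 0, q < log₂ x means 2^(a/b) < x, that is,
-- 2^a < r^b for some rational r with 0 < r < x.
log₂ : ℝ → ℝ
log₂ x q = ∃ λ r → x r × 0ℚᵘ < r × 2^ (↥ q) < r ^ (↧ₙ q)

infix 4 _≟ˢ_
_≟ˢ_ : ∀ {n} → DecidableEquality (Subset n)
_≟ˢ_ = Vec.≡-dec _≟ᵇ_

Disjoint : ∀ {n} → Subset n → Subset n → Set
Disjoint A B = Empty (A ∩ B)

-- The ground set [n] is Fin n.  Nonempty, pairwise disjoint entries are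
-- distinct, so the list has no repeated block and its length counts blocks.
IsPartition : (n k : ℕ) → List (Subset n) → Set
IsPartition n k bs =
  length bs ≡ k × All Nonempty bs × AllPairs Disjoint bs × ⋃ bs ≡ ⊤

isPartition? : ∀ n k bs → Dec (IsPartition n k bs)
isPartition? n k bs =
  length bs ℕ.≟ k ×-dec all? nonempty? bs
    ×-dec allPairs? (λ A B → ¬? (nonempty? (A ∩ B))) bs ×-dec ⋃ bs ≟ˢ ⊤

KPartition : (n k : ℕ) → Set
KPartition n k = Σ (List (Subset n)) (IsPartition n k)

blocks : ∀ {n k} → KPartition n k → List (Subset n)
blocks = proj₁

-- A partition is a set of blocks: the order in which they are listed is
-- irrelevant.
partitionSetoid : (n k : ℕ) → Setoid 0ℓ 0ℓ
partitionSetoid n k = On.setoid {B = KPartition n k} (↭-setoid {A = Subset n}) blocks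

module _ {n k : ℕ} where
  open SetoidMembership (partitionSetoid n k) public using () renaming (_∈_ to _∈ᶠ_)
  open SetoidUnique (partitionSetoid n k) public using (Unique)

module _ {n : ℕ} where
  open DecMembership (_≟ˢ_ {n}) public using () renaming (_∈_ to _∈ᵇ_; _∈?_ to _∈ᵇ?_)

record Family (n k : ℕ) : Set where
  field
    members  : List (KPartition n k)
    distinct : Unique members

open Family public

card : ∀ {n k} → Family n k → ℕ
card F = length (members F)

commonBlocks : ∀ {n k} → KPartition n k → KPartition n k → ℕ
commonBlocks P Q = length (filter (_∈ᵇ? blocks Q) (blocks P))

Intersecting : ∀ {n k} → ℕ → Family n k → Set
Intersecting t F =
  ∀ P Q → P ∈ᶠ members F → Q ∈ᶠ members F → t ℕ.≤ commonBlocks P Q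

-- F consists of all partitions having the singletons { x }, x ∈ T, as blocks,
-- for some fixed T of size t.
FixesSingletons : ∀ {n k} → ℕ → Family n k → Set
FixesSingletons {n} {k} t F =
  Σ (Subset n) λ T → ∣ T ∣ ≡ t ×
    (∀ (P : KPartition n k) →
      P ∈ᶠ members F ⇔ (∀ x → x Sub.∈ T → ⁅ x ⁆ ∈ᵇ blocks P))

allSubsets : ∀ n → List (Subset n)
allSubsets zero    = [ Vec.[] ]
allSubsets (suc n) =
  map (inside Vec.∷_) (allSubsets n) ++ map (outside Vec.∷_) (allSubsets n)

sublists : ∀ {A : Set} → List A → List (List A)
sublists []       = [ [] ]
sublists (x ∷ xs) = map (x ∷_) (sublists xs) ++ sublists xs

-- The number of j-partitions of [m].  Every set of subsets of [m] occurs
-- exactly once, in a fixed order, among the sublists of allSubsets m.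
S : ℕ → ℕ → ℕ
S m j = length (filter (isPartition? m j) (sublists (allSubsets m)))

{-# OPTIONS --safe #-}

-- Write N = n − t, j = k − t and M = S(N, j). Since 2e > 5, the hypothesis gives
-- 2^(N−1) ≥ (5k+1)^(j−1).
--
-- Splitting a block of a p-partition of [m] and AM–GM for the block powers 2^|b| show
-- S(m+1, p+1) ≥ 5k S(m, p) as soon as 2^m ≥ (5k+1)^p. So at most M/(5k)^s partitions contain t + s
-- given blocks, s < j.
--
-- Regard partitions as sets of blocks, and let 𝒯 be a t-intersecting family of sets of size at most
-- q = t + s. Replacing sets by proper subsets, make 𝒯 critical: no element can be removed from any
-- member. If |X| ≥ t and X is properly contained in a q-set of 𝒯, then some U ∈ 𝒯 has |U ∩ X| < t, and
-- every member containing X meets a fixed set of s + 1 elements of U ∖ X. Branching on these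
-- elements, starting from the t-subsets of a q-set, leaves at most C(q, t)(s+1)^s sets of size q.
-- Peeling off the layers q = k, k − 1, … reduces to a single t-set X. If only some members contain
-- X, then they all meet U ∖ X for some U ⊉ X, which costs at most k/(5k) of M. As
-- C(q, t)(s+1)^s ≤ 2·3^(s−1) k^s, the losses form a geometric series of total less than M unless all
-- partitions share the t blocks of X. For j ≥ 3 the top layer is affordable because 2M ≥ (5k)^j.
-- For j = 2 one counts directly, fixing two members and a third one.
--
-- If t common blocks cover u points, the family has at most S(n − u, j) members, which is less
-- than M unless u = t.

module Submission where

import Algebra.Definitions.RawSemiring
open import Data.Bool using (true; false)
open import Data.Fin using (Fin; zero; suc)
open import Data.Fin.Properties using () renaming (_≟_ to _≟ᶠ_)
open import Data.Fin.Subset using (Subset; inside; outside; Nonempty; _∪_; ⋃; ∁; ∣_∣; ⁅_⁆; ⊤; ⊥)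
import Data.Fin.Subset as Sub
import Data.Fin.Subset.Properties as Sub
import Data.Integer as ℤ
import Data.Integer.Properties as ℤ
open import Data.List using (List; []; _∷_; [_]; _++_; map; length; filter; take; drop; concatMap; allFin)
import Data.List.Membership.DecPropositional as DecMembership
open import Data.List.Membership.Propositional using (_∈_; _∉_; find; lose)
open import Data.List.Membership.Propositional.Properties
open import Data.List.Membership.Propositional.Properties.WithK using (unique∧set⇒bag)
open import Data.List.Properties hiding (sum-++)
open import Data.List.Relation.Binary.BagAndSetEquality using (∼bag⇒↭)
open import Data.List.Relation.Binary.Permutation.Propositional using (_↭_; ↭-sym; ↭-refl; ↭-trans; prep)
open import Data.List.Relation.Binary.Permutation.Propositional.Properties using (shift; Any-resp-↭; All-resp-↭; ↭-length)
import Data.List.Relation.Binary.Permutation.Propositional.Properties as ↭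
open import Data.List.Relation.Binary.Subset.Propositional using (_⊆_)
open import Data.List.Relation.Unary.All using (All; []; _∷_; all?)
import Data.List.Relation.Unary.All as All
import Data.List.Relation.Unary.All.Properties as All
open import Data.List.Relation.Unary.AllPairs using (AllPairs; []; _∷_)
import Data.List.Relation.Unary.AllPairs as AllPairs using (map; tail)
import Data.List.Relation.Unary.AllPairs.Properties as AllPairs
open import Data.List.Relation.Unary.Any using (Any; here; there; any?)
import Data.List.Relation.Unary.Any as Any
import Data.List.Relation.Unary.Any.Properties as Any
open import Data.List.Relation.Unary.Unique.Propositional using () renaming (Unique to UniqueList)
import Data.List.Relation.Unary.Unique.Propositional.Properties as Unique
open import Data.Nat hiding (_≟_)
import Data.Nat as ℕ
open import Data.Nat.Combinatorics using (_C_; nC1≡n; nCk+nC[k+1]≡[n+1]C[k+1])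
open import Data.Nat.ListAction using (sum; product)
open import Data.Nat.ListAction.Properties using (sum-++)
open import Data.Nat.Properties hiding (_≟_)
open import Data.Nat.Tactic.RingSolver using (solve-∀)
open import Data.Product using (∃; _×_; _,_; proj₁; proj₂)
open import Data.Rational.Unnormalised using (ℚᵘ; mkℚᵘ; *<*; *≡*)
  renaming (_/_ to _/ℚ_; _+_ to _+ℚ_; _-_ to _-ℚ_; _*_ to _*ℚ_; _<_ to _<ℚ_; _≤_ to _≤ℚ_; _≃_ to _≃ℚ_; -_ to -ℚ_; +-*-rawSemiring to ℚ-rawSemiring)
import Data.Rational.Unnormalised.Properties as ℚ
open import Data.Rational.Unnormalised.Solver using (module +-*-Solver)
open import Data.Sum using (_⊎_; inj₁; inj₂)
open import Data.Unit using (tt)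
import Data.Vec as Vec
import Data.Vec.Properties as Vec
open import Defs
open import Function using (_∘_; id)
open import Function.Bundles using (_⇔_; mk⇔; module Equivalence)
open import Relation.Binary using (DecidableEquality)
open import Relation.Binary.PropositionalEquality hiding ([_]; J)
open import Relation.Nullary using (¬_; Dec; yes; no; ¬?; contradiction)
open import Relation.Nullary.Decidable using (_×-dec_; map′; decidable-stable; from-yes)

-- Pigeonhole for lists up to a relation

module _ {A B : Set} {D : A → A → Set} {R : A → B → Set}
         (separated : ∀ {x x′ y} → R x y → R x′ y → ¬ D x x′) where

  private
    avoid : ∀ {x y} us {vs} xs → R x y → All (D x) xs →
            All (λ x′ → Any (R x′) (us ++ y ∷ vs)) xs → All (λ x′ → Any (R x′) (us ++ vs)) xs
    avoid us [] r [] [] = []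
    avoid {y = y} us {vs} (x′ ∷ xs) r (d ∷ ds) (a ∷ as) with Any-resp-↭ (shift y us vs) a
    ... | here r′ = contradiction d (separated r r′)
    ... | there b = b ∷ avoid us xs r ds as

  -- D is an apartness, such as inequality or not being a reordering. By `separated`, entries that
  -- are apart have no common partner, so the partner of the first entry can be struck from ys
  -- without harm to the rest.
  pigeonhole : ∀ {xs ys} → AllPairs D xs → All (λ x → Any (R x) ys) xs → length xs ≤ length ys
  pigeonhole [] [] = z≤n
  pigeonhole {x ∷ xs} (d ∷ ds) (a ∷ as) with find a
  ... | y , y∈ , r with ∈-∃++ y∈
  ... | us , vs , refl =
    ≤-trans (s≤s (pigeonhole ds (avoid us xs r d as))) (≤-reflexive (sym (↭-length (shift y us vs))))

  -- No partner is left over when ys is not longer than xs. In the equality case of the theorem this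
  -- turns a count into membership.
  pigeonhole-onto : ∀ {xs ys} → AllPairs D xs → All (λ x → Any (R x) ys) xs →
                    length ys ≤ length xs → All (λ y → Any (λ x → R x y) xs) ys
  pigeonhole-onto {ys = []} [] [] le = []
  pigeonhole-onto {x ∷ xs} (d ∷ ds) (a ∷ as) le with find a
  ... | y , y∈ , r with ∈-∃++ y∈
  ... | us , vs , refl =
    All-resp-↭ (↭-sym (shift y us vs))
      (here r ∷ All.map there (pigeonhole-onto ds (avoid us xs r d as)
        (s≤s⁻¹ (≤-trans (≤-reflexive (sym (↭-length (shift y us vs)))) le))))

⊆⇒length≤ : {A : Set} {xs ys : List A} → UniqueList xs → xs ⊆ ys → length xs ≤ length ys
⊆⇒length≤ u sub = pigeonhole {R = _≡_} (λ { refl refl d → d refl }) u (All.tabulate sub)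

-- Deleting a given number of entries

module _ {A : Set} where

  -- omit s xs lists the ways of deleting s entries of xs.
  omit : ℕ → List A → List (List A)
  omit zero    xs       = [ xs ]
  omit (suc s) []       = []
  omit (suc s) (x ∷ xs) = omit s xs ++ map (x ∷_) (omit (suc s) xs)

  length-omit : ∀ s xs → length (omit s xs) ≡ length xs C s
  length-omit zero    xs       = refl
  length-omit (suc s) []       = refl
  length-omit (suc s) (x ∷ xs) = begin
    length (omit s xs ++ map (x ∷_) (omit (suc s) xs))
      ≡⟨ length-++ (omit s xs) ⟩
    length (omit s xs) + length (map (x ∷_) (omit (suc s) xs))
      ≡⟨ cong₂ _+_ (length-omit s xs) (trans (length-map (x ∷_) (omit (suc s) xs)) (length-omit (suc s) xs)) ⟩
    length xs C s + length xs C suc s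
      ≡⟨ nCk+nC[k+1]≡[n+1]C[k+1] (length xs) s ⟩
    suc (length xs) C suc s ∎
    where open ≡-Reasoning

  omit-⊆ : ∀ s xs {L} → L ∈ omit s xs → L ⊆ xs
  omit-⊆ zero    xs (here refl) = id
  omit-⊆ (suc s) (x ∷ xs) L∈ with ∈-++⁻ (omit s xs) L∈
  ... | inj₁ p = there ∘ omit-⊆ s xs p
  ... | inj₂ p with ∈-map⁻ (x ∷_) p
  ... | L′ , L′∈ , refl = λ { (here e) → here e ; (there q) → there (omit-⊆ (suc s) xs L′∈ q) }

  omit-size : ∀ s xs {L} → L ∈ omit s xs → length L + s ≡ length xs
  omit-size zero    xs (here refl) = +-identityʳ (length xs)
  omit-size (suc s) (x ∷ xs) L∈ with ∈-++⁻ (omit s xs) L∈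
  ... | inj₁ p = trans (+-suc _ s) (cong suc (omit-size s xs p))
  ... | inj₂ p with ∈-map⁻ (x ∷_) p
  ... | L′ , L′∈ , refl = cong suc (omit-size (suc s) xs L′∈)

  omit-unique : ∀ s xs {L} → UniqueList xs → L ∈ omit s xs → UniqueList L
  omit-unique zero    xs u (here refl) = u
  omit-unique (suc s) (x ∷ xs) (x≢ ∷ u) L∈ with ∈-++⁻ (omit s xs) L∈
  ... | inj₁ p = omit-unique s xs u p
  ... | inj₂ p with ∈-map⁻ (x ∷_) p
  ... | L′ , L′∈ , refl = All.tabulate (λ q → All.lookup x≢ (omit-⊆ (suc s) xs L′∈ q)) ∷ omit-unique (suc s) xs u L′∈

  -- At most s of the t + s entries fail P, so all of these can be among the s deleted ones. With P
  -- as membership in T, a set that meets T in t elements has a t-subset inside T.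
  omit-covers : {P : A → Set} (P? : ∀ x → Dec (P x)) → ∀ t s xs → length xs ≡ t + s →
                t ≤ length (filter P? xs) → Any (All P) (omit s xs)
  omit-covers P? t zero xs e le = here (All.tabulate λ x∈ → proj₂ (∈-filter⁻ P? {xs = xs} (subst (_ ∈_) (sym same) x∈)))
    where
    same : filter P? xs ≡ xs
    same = filter-all P? (all-kept xs (≤-trans (≤-reflexive (trans e (+-identityʳ t))) le))
      where
      all-kept : ∀ xs → length xs ≤ length (filter P? xs) → All _ xs
      all-kept [] _ = []
      all-kept (x ∷ xs) le with P? x
      ... | yes p = p ∷ all-kept xs (s≤s⁻¹ le)
      ... | no _ = contradiction le (<⇒≱ (s≤s (length-filter P? xs)))
  omit-covers P? zero (suc s) [] () le
  omit-covers P? (suc t) (suc s) [] () le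
  omit-covers P? t (suc s) (x ∷ xs) e le with P? x
  ... | no _ = Any.++⁺ˡ (omit-covers P? t s xs (suc-injective (trans e (+-suc t s))) le)
  -- The t entries to keep have been found; everything else is deleted, whether it satisfies P or
  -- not.
  omit-covers P? zero (suc s) (x ∷ xs) e le | yes p =
    Any.++⁺ˡ (omit-covers P? zero s xs (suc-injective e) z≤n)
  omit-covers P? (suc t) (suc s) (x ∷ xs) e le | yes p =
    Any.++⁺ʳ (omit s xs) (Any.map⁺ (Any.map (p ∷_) (omit-covers P? t (suc s) xs (suc-injective e) (s≤s⁻¹ le))))

length-filter-¬ : {A : Set} {P : A → Set} (P? : ∀ x → Dec (P x)) (xs : List A) →
                  length (filter P? xs) + length (filter (λ x → ¬? (P? x)) xs) ≡ length xs
length-filter-¬ P? [] = refl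
length-filter-¬ P? (x ∷ xs) with P? x
... | yes _ = cong suc (length-filter-¬ P? xs)
... | no _ = trans (+-suc _ _) (cong suc (length-filter-¬ P? xs))

-- Stirling numbers of the second kind

stirling : ℕ → ℕ → ℕ
stirling zero    zero    = 1
stirling zero    (suc k) = 0
stirling (suc n) zero    = 0
stirling (suc n) (suc k) = stirling n k + suc k * stirling n (suc k)

-- Powers, factorials, and the inequality of arithmetic and geometric means

[m*n]^p≡m^p*n^p : ∀ m n p → (m * n) ^ p ≡ m ^ p * n ^ p
[m*n]^p≡m^p*n^p m n zero = refl
[m*n]^p≡m^p*n^p m n (suc p) = trans (cong (m * n *_) ([m*n]^p≡m^p*n^p m n p)) (regroup m n (m ^ p) (n ^ p))
  where
  regroup : ∀ m n x y → m * n * (x * y) ≡ m * x * (n * y)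
  regroup = solve-∀

-- These are the two leading terms of the binomial expansion of (m + 1)^(s+1).
bernoulli : ∀ m s → m ^ suc s + suc s * m ^ s ≤ suc m ^ suc s
bernoulli m zero = ≤-reflexive (expand m)
  where
  expand : ∀ m → m * 1 + 1 ≡ suc m * 1
  expand = solve-∀
bernoulli m (suc s) = begin
  m ^ suc (suc s) + suc (suc s) * m ^ suc s              ≤⟨ m≤m+n _ (suc s * m ^ s) ⟩
  m ^ suc (suc s) + suc (suc s) * m ^ suc s + suc s * m ^ s ≡⟨ regroup m s (m ^ s) ⟩
  suc m * (m ^ suc s + suc s * m ^ s)                    ≤⟨ *-monoʳ-≤ (suc m) (bernoulli m s) ⟩
  suc m ^ suc (suc s)                                    ∎
  where
  open ≤-Reasoning
  regroup : ∀ m s x → m * (m * x) + suc (suc s) * (m * x) + suc s * x ≡ suc m * (m * x + suc s * x)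
  regroup = solve-∀

-- Induction by Pascal's rule; the growth of the right side from m to m + 1 is supplied by
-- `bernoulli`.
binomial-bound : ∀ m s → (m C s) * s ! ≤ m ^ s
binomial-bound m       zero    = ≤-refl
binomial-bound zero    (suc s) = z≤n
binomial-bound (suc m) (suc s) = begin
  (suc m C suc s) * suc s !                  ≡⟨ cong (_* suc s !) (nCk+nC[k+1]≡[n+1]C[k+1] m s) ⟨
  (m C s + m C suc s) * suc s !              ≡⟨ regroup (m C s) (m C suc s) s (s !) ⟩
  (m C suc s) * suc s ! + suc s * ((m C s) * s !) ≤⟨ +-mono-≤ (binomial-bound m (suc s)) (*-monoʳ-≤ (suc s) (binomial-bound m s)) ⟩
  m ^ suc s + suc s * m ^ s                  ≤⟨ bernoulli m s ⟩
  suc m ^ suc s                              ∎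
  where
  open ≤-Reasoning
  regroup : ∀ a b s f → (a + b) * (suc s * f) ≡ b * (suc s * f) + suc s * (a * f)
  regroup = solve-∀

-- (1 + 1/m)^i ≤ 1 + i/m + (i/m)² for i ≤ m, with denominators cleared.
power-bound : ∀ m i → i ≤ m → suc m ^ i * (m * m) ≤ m ^ i * (m * m + i * m + i * i)
power-bound m zero le = ≤-reflexive (expand m)
  where
  expand : ∀ m → 1 * (m * m) ≡ 1 * (m * m + 0 * m + 0 * 0)
  expand = solve-∀
power-bound m (suc i) le = begin
  suc m ^ suc i * (m * m)                     ≡⟨ *-assoc (suc m) (suc m ^ i) (m * m) ⟩
  suc m * (suc m ^ i * (m * m))               ≤⟨ *-monoʳ-≤ (suc m) (power-bound m i (<⇒≤ le)) ⟩
  suc m * (m ^ i * (m * m + i * m + i * i))   ≡⟨ regroup₁ m i (m ^ i) ⟩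
  -- It remains to compare i² with i m + m, and i ≤ m.
  m ^ i * (X + i * i)                         ≤⟨ *-monoʳ-≤ (m ^ i) (+-monoʳ-≤ X (≤-trans (*-monoʳ-≤ i (<⇒≤ le)) (m≤m+n (i * m) m))) ⟩
  m ^ i * (X + (i * m + m))                   ≡⟨ regroup₂ m i (m ^ i) ⟩
  m ^ suc i * (m * m + suc i * m + suc i * suc i) ∎
  where
  open ≤-Reasoning
  X = m * m * m + i * (m * m) + i * i * m + m * m + i * m
  regroup₁ : ∀ m i x → suc m * (x * (m * m + i * m + i * i)) ≡ x * (m * m * m + i * (m * m) + i * i * m + m * m + i * m + i * i)
  regroup₁ = solve-∀
  regroup₂ : ∀ m i x → x * (m * m * m + i * (m * m) + i * i * m + m * m + i * m + (i * m + m)) ≡ m * x * (m * m + suc i * m + suc i * suc i)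
  regroup₂ = solve-∀

-- The case i = m of `power-bound`. The constant 3, in place of e, becomes the numerator of the
-- ratio 3/5 of the geometric series of losses.
[1+m]^m≤3m^m : ∀ m .{{_ : NonZero m}} → suc m ^ m ≤ 3 * m ^ m
[1+m]^m≤3m^m m@(suc _) = *-cancelʳ-≤ _ _ (m * m) (begin
  suc m ^ m * (m * m)               ≤⟨ power-bound m m ≤-refl ⟩
  m ^ m * (m * m + m * m + m * m)   ≡⟨ regroup (m ^ m) (m * m) ⟩
  3 * m ^ m * (m * m)               ∎)
  where
  open ≤-Reasoning
  regroup : ∀ x y → x * (y + y + y) ≡ 3 * x * y
  regroup = solve-∀

-- From s to s + 1 the left side grows by a factor of at most 3(s + 2). This bounds the branching
-- number of a layer divided by the factorial from the binomial coefficient.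
[1+s]^s≤s!*2*3^ : ∀ s → suc (suc s) ^ suc s ≤ suc s ! * (2 * 3 ^ s)
[1+s]^s≤s!*2*3^ zero = ≤-refl
[1+s]^s≤s!*2*3^ (suc s) = begin
  (3 + s) ^ (2 + s)                          ≤⟨ [1+m]^m≤3m^m (2 + s) ⟩
  3 * ((2 + s) * (2 + s) ^ (1 + s))          ≤⟨ *-monoʳ-≤ 3 (*-monoʳ-≤ (2 + s) ([1+s]^s≤s!*2*3^ s)) ⟩
  3 * ((2 + s) * (suc s ! * (2 * 3 ^ s)))    ≡⟨ regroup (2 + s) (suc s !) (3 ^ s) ⟩
  (2 + s) * suc s ! * (2 * (3 * 3 ^ s))      ∎
  where
  open ≤-Reasoning
  regroup : ∀ a f x → 3 * (a * (f * (2 * x))) ≡ a * f * (2 * (3 * x))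
  regroup = solve-∀

2uv≤u²+v² : ∀ u v → 2 * (u * v) ≤ u * u + v * v
2uv≤u²+v² u v with ≤-total u v
... | inj₁ le = subst (λ v → 2 * (u * v) ≤ u * u + v * v) (m+[n∸m]≡n le) (≤-trans (m≤m+n _ (d * d)) (≤-reflexive (expand u d)))
  where
  d = v ∸ u
  expand : ∀ u d → 2 * (u * (u + d)) + d * d ≡ u * u + (u + d) * (u + d)
  expand = solve-∀
... | inj₂ le = subst (λ u → 2 * (u * v) ≤ u * u + v * v) (m+[n∸m]≡n le) (≤-trans (m≤m+n _ (d * d)) (≤-reflexive (expand v d)))
  where
  d = u ∸ v
  expand : ∀ v d → 2 * ((v + d) * v) + d * d ≡ (v + d) * (v + d) + v * v
  expand = solve-∀

-- Induction: the case p is multiplied by u, and 2uv ≤ u² + v² is multiplied by (p + 1)v^p. The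
-- surplus p u v^(p+1) on both sides is cancelled at the end.
weighted-am-gm : ∀ p u v → suc p * (u * v ^ p) ≤ u ^ suc p + p * v ^ suc p
weighted-am-gm zero u v = ≤-reflexive (expand u)
  where
  expand : ∀ u → 1 * (u * 1) ≡ u * 1 + 0
  expand = solve-∀
weighted-am-gm (suc p) u v = +-cancelʳ-≤ (p * (u * v ^ suc p)) _ _ (begin
  suc (suc p) * (u * v ^ suc p) + p * (u * v ^ suc p) ≡⟨ regroup₁ p u v (v ^ p) ⟩
  suc p * v ^ p * (2 * (u * v))                       ≤⟨ *-monoʳ-≤ (suc p * v ^ p) (2uv≤u²+v² u v) ⟩
  suc p * v ^ p * (u * u + v * v)                     ≡⟨ regroup₂ p u v (v ^ p) ⟩
  u * (suc p * (u * v ^ p)) + suc p * v ^ suc (suc p) ≤⟨ +-monoˡ-≤ _ (*-monoʳ-≤ u (weighted-am-gm p u v)) ⟩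
  u * (u ^ suc p + p * v ^ suc p) + suc p * v ^ suc (suc p) ≡⟨ regroup₃ p u v (v ^ p) (u ^ p) ⟩
  u ^ suc (suc p) + suc p * v ^ suc (suc p) + p * (u * v ^ suc p) ∎)
  where
  open ≤-Reasoning
  regroup₁ : ∀ p u v x → suc (suc p) * (u * (v * x)) + p * (u * (v * x)) ≡ suc p * x * (2 * (u * v))
  regroup₁ = solve-∀
  regroup₂ : ∀ p u v x → suc p * x * (u * u + v * v) ≡ u * (suc p * (u * x)) + suc p * (v * (v * x))
  regroup₂ = solve-∀
  regroup₃ : ∀ p u v x y → u * (u * y + p * (v * x)) + suc p * (v * (v * x)) ≡ u * (u * y) + suc p * (v * (v * x)) + p * (u * (v * x))
  regroup₃ = solve-∀

-- Below, u and v are the means of the whole list and of its tail, both scaled by p(p + 1). The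
-- weighted inequality, less p v^(p+1), reads p(p + 1) x v^p ≤ u^(p+1), and the induction hypothesis
-- bounds the product of the tail. One-element lists are separate because p must be cancelled.
am-gm : ∀ xs → length xs ^ length xs * product xs ≤ sum xs ^ length xs
am-gm [] = ≤-refl
am-gm (x ∷ []) = ≤-reflexive (expand x)
  where
  expand : ∀ x → 1 * 1 * (x * 1) ≡ (x + 0) * 1
  expand = solve-∀
am-gm (x ∷ xs@(_ ∷ _)) = *-cancelˡ-≤ (p ^ p) {{m^n≢0 p p}} (*-cancelˡ-≤ p (begin
  p * (p ^ p * (suc p ^ suc p * (x * product xs)))  ≡⟨ regroup₁ p (p ^ p) (suc p ^ p) x (product xs) ⟩
  p * (suc p * (x * (suc p ^ p * (p ^ p * product xs)))) ≤⟨ *-monoʳ-≤ p (*-monoʳ-≤ (suc p) (*-monoʳ-≤ x (*-monoʳ-≤ (suc p ^ p) (am-gm xs)))) ⟩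
  p * (suc p * (x * (suc p ^ p * s ^ p)))           ≡⟨ cong (λ y → p * (suc p * (x * y))) ([m*n]^p≡m^p*n^p (suc p) s p) ⟨
  p * (suc p * (x * v ^ p))                         ≤⟨ +-cancelʳ-≤ (p * v ^ suc p) _ _ (≤-trans (≤-reflexive (regroup₂ p x s (v ^ p))) (weighted-am-gm p u v)) ⟩
  u ^ suc p                                         ≡⟨ [m*n]^p≡m^p*n^p p (x + s) (suc p) ⟩
  p ^ suc p * (x + s) ^ suc p                       ≡⟨ *-assoc p (p ^ p) _ ⟩
  p * (p ^ p * (x + s) ^ suc p)                     ∎))
  where
  open ≤-Reasoning
  p = length xs
  s = sum xs
  u = p * (x + s)
  v = suc p * s
  regroup₁ : ∀ p y z x w → p * (y * (suc p * z * (x * w))) ≡ p * (suc p * (x * (z * (y * w))))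
  regroup₁ = solve-∀
  regroup₂ : ∀ p x s y → p * (suc p * (x * y)) + p * (suc p * s * y) ≡ suc p * (p * (x + s) * y)
  regroup₂ = solve-∀

-- Growth of the Stirling numbers

doublings : List ℕ → List (List ℕ)
doublings []       = []
doublings (x ∷ xs) = (2 * x ∷ xs) ∷ map (x ∷_) (doublings xs)

-- The lists of 2^|b|, b running over the blocks, for the p-partitions of [m].
blockPowers : ℕ → ℕ → List (List ℕ)
blockPowers zero    zero    = [ [] ]
blockPowers zero    (suc p) = []
blockPowers (suc m) zero    = []
blockPowers (suc m) (suc p) = map (2 ∷_) (blockPowers m p) ++ concatMap doublings (blockPowers m (suc p))

PowerList : ℕ → ℕ → List ℕ → Set
PowerList m p xs = length xs ≡ p × product xs ≡ 2 ^ m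

doublings-props : ∀ xs → All (λ ys → length ys ≡ length xs × product ys ≡ 2 * product xs) (doublings xs)
doublings-props [] = []
doublings-props (x ∷ xs) = (refl , *-assoc 2 x (product xs)) ∷
  All.map⁺ (All.map (λ { (l , e) → cong suc l , trans (cong (x *_) e) (regroup x (product xs)) }) (doublings-props xs))
  where
  regroup : ∀ x y → x * (2 * y) ≡ 2 * (x * y)
  regroup = solve-∀

blockPowers-props : ∀ m p → All (PowerList m p) (blockPowers m p)
blockPowers-props zero zero = (refl , refl) ∷ []
blockPowers-props zero (suc p) = []
blockPowers-props (suc m) zero = []
blockPowers-props (suc m) (suc p) = All.++⁺
  (All.map⁺ (All.map (λ { (l , e) → cong suc l , cong (2 *_) e }) (blockPowers-props m p)))
  (All.concat⁺ (All.map⁺ (All.map (λ { {xs} (l , e) → All.map (λ { (l′ , e′) → trans l′ l , trans e′ (cong (2 *_) e) }) (doublings-props xs) })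
    (blockPowers-props m (suc p)))))

length-doublings : ∀ xs → length (doublings xs) ≡ length xs
length-doublings [] = refl
length-doublings (x ∷ xs) = cong suc (trans (length-map (x ∷_) (doublings xs)) (length-doublings xs))

length-concatMap : ∀ {A C : Set} (f : A → List C) {c} {xs} → All (λ x → length (f x) ≡ c) xs →
                   length (concatMap f xs) ≡ c * length xs
length-concatMap f {c} [] = sym (*-zeroʳ c)
length-concatMap f {c} {x ∷ xs} (e ∷ a) = begin
  length (f x ++ concatMap f xs)           ≡⟨ length-++ (f x) ⟩
  length (f x) + length (concatMap f xs)   ≡⟨ cong₂ _+_ e (length-concatMap f a) ⟩
  c + c * length xs                        ≡⟨ *-suc c (length xs) ⟨
  c * suc (length xs)                      ∎
  where open ≡-Reasoning

length-blockPowers : ∀ m p → length (blockPowers m p) ≡ stirling m p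
length-blockPowers zero zero = refl
length-blockPowers zero (suc p) = refl
length-blockPowers (suc m) zero = refl
length-blockPowers (suc m) (suc p) = trans (length-++ (map (2 ∷_) (blockPowers m p))) (cong₂ _+_
  (trans (length-map (2 ∷_) (blockPowers m p)) (length-blockPowers m p))
  (trans (length-concatMap doublings (All.map (λ { {xs} (l , _) → trans (length-doublings xs) l }) (blockPowers-props m (suc p))))
         (cong (suc p *_) (length-blockPowers m (suc p)))))

total : List (List ℕ) → ℕ
total xss = sum (map sum xss)

total-++ : ∀ xss yss → total (xss ++ yss) ≡ total xss + total yss
total-++ xss yss = trans (cong sum (map-++ sum xss yss)) (sum-++ (map sum xss) (map sum yss))

total-∷ : ∀ x xss → total (map (x ∷_) xss) ≡ x * length xss + total xss
total-∷ x [] = sym (trans (+-identityʳ _) (*-zeroʳ x))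
total-∷ x (xs ∷ xss) = trans (cong (x + sum xs +_) (total-∷ x xss)) (regroup x (sum xs) (length xss) (total xss))
  where
  regroup : ∀ x a l b → x + a + (x * l + b) ≡ x * suc l + (a + b)
  regroup = solve-∀

-- Every entry occurs in each of the `length xs` lists and is doubled in exactly one of them.
total-doublings : ∀ xs → total (doublings xs) ≡ suc (length xs) * sum xs
total-doublings [] = refl
total-doublings (x ∷ xs) = begin
  2 * x + sum xs + total (map (x ∷_) (doublings xs))
    ≡⟨ cong (2 * x + sum xs +_) (total-∷ x (doublings xs)) ⟩
  2 * x + sum xs + (x * length (doublings xs) + total (doublings xs))
    ≡⟨ cong (2 * x + sum xs +_) (cong₂ _+_ (cong (x *_) (length-doublings xs)) (total-doublings xs)) ⟩
  2 * x + sum xs + (x * length xs + suc (length xs) * sum xs)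
    ≡⟨ regroup x (sum xs) (length xs) ⟩
  suc (suc (length xs)) * (x + sum xs) ∎
  where
  open ≡-Reasoning
  regroup : ∀ x s l → 2 * x + s + (x * l + suc l * s) ≡ suc (suc l) * (x + s)
  regroup = solve-∀

total-concatMap-doublings : ∀ {p} xss → All (λ xs → length xs ≡ p) xss → total (concatMap doublings xss) ≡ suc p * total xss
total-concatMap-doublings {p} [] [] = sym (*-zeroʳ (suc p))
total-concatMap-doublings {p} (xs ∷ xss) (e ∷ a) = begin
  total (doublings xs ++ concatMap doublings xss)         ≡⟨ total-++ (doublings xs) _ ⟩
  total (doublings xs) + total (concatMap doublings xss)  ≡⟨ cong₂ _+_ (trans (total-doublings xs) (cong (λ l → suc l * sum xs) e)) (total-concatMap-doublings xss a) ⟩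
  suc p * sum xs + suc p * total xss                      ≡⟨ *-distribˡ-+ (suc p) (sum xs) (total xss) ⟨
  suc p * (sum xs + total xss)                            ∎
  where open ≡-Reasoning

-- A block b splits into two in 2^(|b|−1) − 1 ways, and a (p+1)-partition arises by such
-- a split from p(p+1)/2 of the p-partitions.
total-blockPowers : ∀ m p → total (blockPowers m p) ≡ p * suc p * stirling m (suc p) + 2 * p * stirling m p
total-blockPowers zero zero = refl
total-blockPowers zero (suc p) = sym (cong₂ _+_ (*-zeroʳ (suc p * suc (suc p))) (*-zeroʳ (2 * suc p)))
total-blockPowers (suc m) zero = refl
total-blockPowers (suc m) (suc p) = begin
  total (map (2 ∷_) (blockPowers m p) ++ concatMap doublings (blockPowers m (suc p)))
    ≡⟨ total-++ (map (2 ∷_) (blockPowers m p)) _ ⟩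
  total (map (2 ∷_) (blockPowers m p)) + total (concatMap doublings (blockPowers m (suc p)))
    ≡⟨ cong₂ _+_ (trans (total-∷ 2 (blockPowers m p)) (cong₂ _+_ (cong (2 *_) (length-blockPowers m p)) (total-blockPowers m p)))
                 (trans (total-concatMap-doublings (blockPowers m (suc p)) (All.map proj₁ (blockPowers-props m (suc p))))
                        (cong (suc (suc p) *_) (total-blockPowers m (suc p)))) ⟩
  2 * stirling m p + (p * suc p * stirling m (suc p) + 2 * p * stirling m p) +
    suc (suc p) * (suc p * suc (suc p) * stirling m (suc (suc p)) + 2 * suc p * stirling m (suc p))
    ≡⟨ regroup p (stirling m p) (stirling m (suc p)) (stirling m (suc (suc p))) ⟩
  suc p * suc (suc p) * stirling (suc m) (suc (suc p)) + 2 * suc p * stirling (suc m) (suc p) ∎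
  where
  open ≡-Reasoning
  regroup : ∀ p a b c → 2 * a + (p * suc p * b + 2 * p * a) + suc (suc p) * (suc p * suc (suc p) * c + 2 * suc p * b)
                      ≡ suc p * suc (suc p) * (b + suc (suc p) * c) + 2 * suc p * (a + suc p * b)
  regroup = solve-∀

-- AM-GM without roots: with q = p + 1, a sum below q r would have its q-th power below q^q r^q ≤
-- q^q 2^m, but the block powers have product 2^m.
sum-≥ : ∀ {p r m xs} → r ^ suc p ≤ 2 ^ m → PowerList m (suc p) xs → suc p * r ≤ sum xs
sum-≥ {p} {r} {m} {xs} le (l , e) = ≮⇒≥ λ lt → <⇒≱ (^-monoˡ-< q lt) (begin
  (q * r) ^ q                          ≡⟨ [m*n]^p≡m^p*n^p q r q ⟩
  q ^ q * r ^ q                        ≤⟨ *-monoʳ-≤ (q ^ q) le ⟩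
  q ^ q * 2 ^ m                        ≡⟨ cong₂ (λ a b → a ^ a * b) l e ⟨
  length xs ^ length xs * product xs   ≤⟨ am-gm xs ⟩
  sum xs ^ length xs                   ≡⟨ cong (sum xs ^_) l ⟩
  sum xs ^ q                           ∎)
  where
  open ≤-Reasoning
  q = suc p

total-≥ : ∀ {c xss} → All (λ xs → c ≤ sum xs) xss → c * length xss ≤ total xss
total-≥ {c} [] = ≤-reflexive (*-zeroʳ c)
total-≥ {c} {xs ∷ xss} (le ∷ a) = ≤-trans (≤-reflexive (*-suc c (length xss))) (+-mono-≤ le (total-≥ a))

-- With q = p + 1, `sum-≥` bounds the total of all block powers from below by q(r + 1) S(m, q),
-- while `total-blockPowers` evaluates it as q(S(m, q) + S(m + 1, q + 1)). Cancelling one S(m, q)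
-- turns r + 1 into r.
stirling-ratio : ∀ {r} m p → suc r ^ suc p ≤ 2 ^ m → r * stirling m (suc p) ≤ stirling (suc m) (suc (suc p))
stirling-ratio {r} m p le = +-cancelˡ-≤ (stirling m q) _ _ (*-cancelˡ-≤ q (begin
  q * (stirling m q + r * stirling m q)                 ≡⟨ *-assoc q (suc r) (stirling m q) ⟨
  q * suc r * stirling m q                              ≡⟨ cong (q * suc r *_) (length-blockPowers m q) ⟨
  q * suc r * length (blockPowers m q)                  ≤⟨ total-≥ (All.map (λ {xs} → sum-≥ {r = suc r} {m} {xs} le) (blockPowers-props m q)) ⟩
  total (blockPowers m q)                               ≡⟨ total-blockPowers m q ⟩
  q * suc q * stirling m (suc q) + 2 * q * stirling m q ≡⟨ regroup q (suc q) (stirling m q) (stirling m (suc q)) ⟩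
  q * (stirling m q + stirling (suc m) (suc q))         ∎))
  where
  open ≤-Reasoning
  q = suc p
  regroup : ∀ q c a b → q * c * b + 2 * q * a ≡ q * (a + (a + c * b))
  regroup = solve-∀

-- The ratio is iterated s times. Its hypothesis survives each step, since lowering m by one halves
-- 2^m while the other side loses a factor r + 1 ≥ 2.
stirling-ratios : ∀ {r} s p m → 1 ≤ r → suc r ^ (s + p) ≤ 2 ^ m →
  ∃ λ m′ → m ≡ s + m′ × suc r ^ p ≤ 2 ^ m′ × r ^ s * stirling (suc m′) (suc p) ≤ stirling (suc m) (suc (s + p))
stirling-ratios zero p m 1≤r le = m , refl , le , ≤-reflexive (*-identityˡ _)
stirling-ratios {r} (suc s) p zero 1≤r le = contradiction le
  (<⇒≱ (≤-trans (s≤s 1≤r) (m≤m*n (suc r) (suc r ^ (s + p)) {{m^n≢0 (suc r) (s + p)}})))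
stirling-ratios {r} (suc s) p (suc m) 1≤r le
  with stirling-ratios s p m 1≤r (*-cancelˡ-≤ 2 (≤-trans (*-monoˡ-≤ (suc r ^ (s + p)) (s≤s 1≤r)) le))
... | m′ , e , le′ , bound = m′ , cong suc e , le′ , (begin
  r * r ^ s * stirling (suc m′) (suc p)   ≡⟨ *-assoc r (r ^ s) _ ⟩
  r * (r ^ s * stirling (suc m′) (suc p)) ≤⟨ *-monoʳ-≤ r bound ⟩
  r * stirling (suc m) (suc (s + p))      ≤⟨ stirling-ratio (suc m) (s + p) le ⟩
  stirling (suc (suc m)) (suc (suc (s + p))) ∎)
  where open ≤-Reasoning

stirling-1 : ∀ m → stirling (suc m) 1 ≡ 1
stirling-1 zero = refl
stirling-1 (suc m) = trans (*-identityˡ _) (stirling-1 m)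

stirling-2 : ∀ m → suc (stirling (suc m) 2) ≡ 2 ^ m
stirling-2 zero = refl
stirling-2 (suc m) = begin
  suc (stirling (suc m) 1 + 2 * stirling (suc m) 2) ≡⟨ cong (λ x → suc (x + 2 * stirling (suc m) 2)) (stirling-1 m) ⟩
  2 + 2 * stirling (suc m) 2                        ≡⟨ *-suc 2 (stirling (suc m) 2) ⟨
  2 * suc (stirling (suc m) 2)                      ≡⟨ cong (2 *_) (stirling-2 m) ⟩
  2 * 2 ^ m                                         ∎
  where open ≡-Reasoning

-- The iteration stops at two blocks, where S(m′ + 1, 2) = 2^m′ - 1 is at least r²/2 because (r +
-- 1)² - 2 ≥ r². Going down to one block would give one factor r less.
stirling-large : ∀ {r} p m → 1 ≤ r → suc r ^ (2 + p) ≤ 2 ^ m → r ^ (3 + p) ≤ 2 * stirling (suc m) (3 + p)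
stirling-large {r} p m 1≤r le with stirling-ratios p 2 m 1≤r (subst (λ e → suc r ^ e ≤ 2 ^ m) (+-comm 2 p) le)
... | zero , _ , le₂ , _ = contradiction (*-mono-≤ {2} {suc r} {1} (s≤s 1≤r) (s≤s z≤n)) (<⇒≱ (s≤s le₂))
... | suc m′ , _ , le₂ , bound = begin
  r ^ (3 + p)                                 ≡⟨ cong (r ^_) (+-comm 3 p) ⟩
  r ^ (p + 3)                                 ≡⟨ ^-distribˡ-+-* r p 3 ⟩
  r ^ p * (r * (r * (r * 1)))                 ≤⟨ *-monoʳ-≤ (r ^ p) (*-monoʳ-≤ r square) ⟩
  r ^ p * (r * (2 * stirling (suc m′) 2))     ≡⟨ regroup (r ^ p) r (stirling (suc m′) 2) ⟩
  2 * (r ^ p * (r * stirling (suc m′) 2))     ≤⟨ *-monoʳ-≤ 2 (*-monoʳ-≤ (r ^ p) (stirling-ratio {r} (suc m′) 1 le₂)) ⟩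
  2 * (r ^ p * stirling (suc (suc m′)) 3)     ≤⟨ *-monoʳ-≤ 2 bound ⟩
  2 * stirling (suc m) (suc (p + 2))          ≡⟨ cong (λ e → 2 * stirling (suc m) (suc e)) (+-comm p 2) ⟩
  2 * stirling (suc m) (3 + p)                ∎
  where
  open ≤-Reasoning
  regroup : ∀ x r y → x * (r * (2 * y)) ≡ 2 * (x * (r * y))
  regroup = solve-∀
  expand : ∀ r → suc (r + r) + r * (r * 1) ≡ suc r * (suc r * 1)
  expand = solve-∀
  square : r * (r * 1) ≤ 2 * stirling (suc m′) 2
  square = +-cancelˡ-≤ 2 _ _ (begin
    2 + r * (r * 1)                ≤⟨ +-monoˡ-≤ (r * (r * 1)) (s≤s (≤-trans 1≤r (m≤m+n r r))) ⟩
    suc (r + r) + r * (r * 1)      ≡⟨ expand r ⟩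
    suc r * (suc r * 1)            ≤⟨ le₂ ⟩
    2 * 2 ^ m′                     ≡⟨ cong (2 *_) (stirling-2 m′) ⟨
    2 * suc (stirling (suc m′) 2)  ≡⟨ *-suc 2 (stirling (suc m′) 2) ⟩
    2 + 2 * stirling (suc m′) 2    ∎)

-- Going down to a single block even gives the lower bound r^p.
stirling-positive : ∀ {r} p m → 1 ≤ r → suc r ^ p ≤ 2 ^ m → 1 ≤ stirling (suc m) (suc p)
stirling-positive {r} p m 1≤r le with stirling-ratios p 0 m 1≤r (subst (λ e → suc r ^ e ≤ 2 ^ m) (sym (+-identityʳ p)) le)
... | m′ , _ , _ , bound = begin
  1                             ≤⟨ m^n>0 r {{>-nonZero 1≤r}} p ⟩
  r ^ p                         ≡⟨ *-identityʳ (r ^ p) ⟨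
  r ^ p * 1                     ≡⟨ cong (r ^ p *_) (stirling-1 m′) ⟨
  r ^ p * stirling (suc m′) 1   ≤⟨ bound ⟩
  stirling (suc m) (suc (p + 0)) ≡⟨ cong (λ e → stirling (suc m) (suc e)) (+-identityʳ p) ⟩
  stirling (suc m) (suc p)      ∎
  where open ≤-Reasoning

stirling-mono : ∀ {m n} k → m ≤ n → stirling m (suc k) ≤ stirling n (suc k)
stirling-mono k le = go (≤⇒≤′ le)
  where
  go : ∀ {m n} → m ≤′ n → stirling m (suc k) ≤ stirling n (suc k)
  go ≤′-refl = ≤-refl
  go (≤′-step {n} le) = ≤-trans (go le) (≤-trans (m≤m+n _ (k * stirling n (suc k))) (m≤n+m _ (stirling n k)))

-- The factor 2 + k of the recurrence at least doubles a positive value; for the value 0 the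
-- hypothesis is the claim.
stirling-strict : ∀ n k → 1 ≤ stirling (suc n) (2 + k) → stirling n (2 + k) < stirling (suc n) (2 + k)
stirling-strict n k = strict (stirling n (suc k)) (stirling n (2 + k))
  where
  strict : ∀ a x → 1 ≤ a + (2 + k) * x → x < a + (2 + k) * x
  strict a zero    pos = pos
  strict a (suc x) _   = ≤-trans (m<m+n (suc x) z<s) (m≤n+m _ a)

-- The total loss of the peeling

module Budget (t k : ℕ) (g : ℕ → ℕ) where

  -- The number of sets of size t + s left by the branching, times g s, which is to bound the number
  -- of partitions containing t + s given blocks.
  layer : ℕ → ℕ
  layer s = ((t + s) C s) * suc s ^ s * g s

  -- Taking 2k g(1) instead of layer 1 = 2(t + 1) g(1) ensures that budget s, s ≥ 1, also pays for
  -- the at most k sets {y} ∪ X in the last case of peel.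
  budget : ℕ → ℕ
  budget 0             = 0
  budget 1             = 2 * k * g 1
  budget (suc (suc s)) = budget (suc s) + layer (suc (suc s))

  budget-step : ∀ s → t + suc s ≤ k → layer (suc s) + budget s ≤ budget (suc s)
  budget-step zero le = begin
    ((t + 1) C 1) * (2 * 1) * g 1 + 0 ≡⟨ cong (λ n → n * 2 * g 1 + 0) (nC1≡n (t + 1)) ⟩
    (t + 1) * 2 * g 1 + 0           ≡⟨ cong (λ n → n * g 1 + 0) (*-comm (t + 1) 2) ⟩
    2 * (t + 1) * g 1 + 0           ≡⟨ +-identityʳ _ ⟩
    2 * (t + 1) * g 1               ≤⟨ *-monoˡ-≤ (g 1) (*-monoʳ-≤ 2 le) ⟩
    2 * k * g 1                     ∎
    where open ≤-Reasoning
  budget-step (suc s) le = ≤-reflexive (+-comm (layer (suc (suc s))) (budget (suc s)))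

  budget-≥ : ∀ s → k * g 1 ≤ budget (suc s)
  budget-≥ zero = *-monoˡ-≤ (g 1) (m≤m+n k (k + 0))
  budget-≥ (suc s) = ≤-trans (budget-≥ s) (m≤m+n _ _)

  -- The factorials from `binomial-bound` and `[1+s]^s≤s!*2*3^` cancel. What remains of the binomial
  -- coefficient is at most k^(s+1), which (5k)^(s+1) absorbs up to the power of 5.
  layer-≤ : ∀ s {M} → t + suc s ≤ k → (5 * k) ^ suc s * g (suc s) ≤ M → 5 ^ suc s * layer (suc s) ≤ 2 * 3 ^ s * M
  layer-≤ s {M} t+s≤k bound = begin
    5 ^ suc s * (c * (2 + s) ^ suc s * g (suc s))
      ≤⟨ *-monoʳ-≤ (5 ^ suc s) (*-monoˡ-≤ (g (suc s)) (*-monoʳ-≤ c ([1+s]^s≤s!*2*3^ s))) ⟩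
    5 ^ suc s * (c * (suc s ! * (2 * 3 ^ s)) * g (suc s))
      ≡⟨ regroup₁ (5 ^ suc s) c (suc s !) (2 * 3 ^ s) (g (suc s)) ⟩
    2 * 3 ^ s * (5 ^ suc s * (c * suc s !) * g (suc s))
      ≤⟨ *-monoʳ-≤ (2 * 3 ^ s) (*-monoˡ-≤ (g (suc s)) (*-monoʳ-≤ (5 ^ suc s)
           (≤-trans (binomial-bound (t + suc s) (suc s)) (^-monoˡ-≤ (suc s) t+s≤k)))) ⟩
    2 * 3 ^ s * (5 ^ suc s * k ^ suc s * g (suc s))
      ≡⟨ cong (λ x → 2 * 3 ^ s * (x * g (suc s))) ([m*n]^p≡m^p*n^p 5 k (suc s)) ⟨
    2 * 3 ^ s * ((5 * k) ^ suc s * g (suc s))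
      ≤⟨ *-monoʳ-≤ (2 * 3 ^ s) bound ⟩
    2 * 3 ^ s * M ∎
    where
    open ≤-Reasoning
    c = (t + suc s) C suc s
    regroup₁ : ∀ x c f y z → x * (c * (f * y) * z) ≡ y * (x * (c * f) * z)
    regroup₁ = solve-∀

  module _ {M p : ℕ} (t+p≤k : t + p ≤ k) (small : ∀ s → suc s ≤ p → (5 * k) ^ suc s * g (suc s) ≤ M) where

    -- Layer s + 1 costs at most (2/5)(3/5)^s M, and these terms for 0, ..., s add up to (1 -
    -- (3/5)^(s+1)) M. Denominators are cleared.
    budget-geometric : ∀ s → suc s ≤ p → 5 ^ suc s * budget (suc s) + 3 ^ suc s * M ≤ 5 ^ suc s * M
    budget-geometric zero le = begin
      5 * (2 * k * g 1) + 3 * M          ≡⟨ cong (_+ 3 * M) (regroup k (g 1)) ⟩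
      2 * ((5 * k) * 1 * g 1) + 3 * M    ≤⟨ +-monoˡ-≤ (3 * M) (*-monoʳ-≤ 2 (small 0 le)) ⟩
      2 * M + 3 * M                      ≡⟨ *-distribʳ-+ M 2 3 ⟨
      5 * M                              ∎
      where
      open ≤-Reasoning
      regroup : ∀ k g → 5 * (2 * k * g) ≡ 2 * ((5 * k) * 1 * g)
      regroup = solve-∀
    budget-geometric (suc s) le = begin
      5 * f * (b + l) + 3 * (3 ^ suc s) * M           ≡⟨ regroup₁ f b l (3 ^ suc s) M ⟩
      5 * (f * b) + 5 * f * l + 3 * (3 ^ suc s * M)   ≤⟨ +-monoˡ-≤ (3 * (3 ^ suc s * M)) (+-monoʳ-≤ (5 * (f * b))
                                                           (layer-≤ (suc s) (≤-trans (+-monoʳ-≤ t le) t+p≤k) (small (suc s) le))) ⟩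
      5 * (f * b) + 2 * 3 ^ suc s * M + 3 * (3 ^ suc s * M) ≡⟨ regroup₂ (f * b) (3 ^ suc s) M ⟩
      5 * (f * b + 3 ^ suc s * M)                     ≤⟨ *-monoʳ-≤ 5 (budget-geometric s (<⇒≤ le)) ⟩
      5 * (f * M)                                     ≡⟨ *-assoc 5 f M ⟨
      5 * f * M                                       ∎
      where
      open ≤-Reasoning
      f = 5 ^ suc s
      b = budget (suc s)
      l = layer (2 + s)
      regroup₁ : ∀ f b l x M → 5 * f * (b + l) + 3 * x * M ≡ 5 * (f * b) + 5 * f * l + 3 * (x * M)
      regroup₁ = solve-∀
      regroup₂ : ∀ y x M → 5 * y + 2 * x * M + 3 * (x * M) ≡ 5 * (y + x * M)
      regroup₂ = solve-∀

  -- The last layer is controlled only through 2M, so it may cost (4/5)(3/5)^(p+1) M. This is still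
  -- less than the remainder (3/5)^(p+1) M left by the geometric series.
  budget-< : ∀ {M} p → t + (2 + p) ≤ k → 1 ≤ M → (∀ s → suc s ≤ suc p → (5 * k) ^ suc s * g (suc s) ≤ M) →
             (5 * k) ^ (2 + p) * g (2 + p) ≤ 2 * M → budget (2 + p) < M
  budget-< {M} p t+p≤k 1≤M small last = *-cancelˡ-< (5 * f) _ _ (begin-strict
    5 * f * (b + l)                         ≡⟨ *-distribˡ-+ (5 * f) b l ⟩
    5 * f * b + 5 * f * l                   ≤⟨ +-monoʳ-≤ (5 * f * b) (layer-≤ (suc p) t+p≤k last) ⟩
    5 * f * b + 2 * h * (2 * M)             <⟨ m<m+n _ {h * M} (*-mono-≤ (m^n>0 3 (suc p)) 1≤M) ⟩
    5 * f * b + 2 * h * (2 * M) + h * M     ≡⟨ regroup f b h M ⟩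
    5 * (f * b + h * M)                     ≤⟨ *-monoʳ-≤ 5 (budget-geometric {p = suc p} (≤-trans (+-monoʳ-≤ t (n≤1+n (suc p))) t+p≤k) small p ≤-refl) ⟩
    5 * (f * M)                             ≡⟨ *-assoc 5 f M ⟨
    5 * f * M                               ∎)
    where
    open ≤-Reasoning
    f = 5 ^ suc p
    h = 3 ^ suc p
    b = budget (suc p)
    l = layer (2 + p)
    regroup : ∀ f b h M → 5 * f * b + 2 * h * (2 * M) + h * M ≡ 5 * (f * b + h * M)
    regroup = solve-∀

-- Lower cuts

module Cuts where
  open import Data.Integer using (+_)

  open Algebra.Definitions.RawSemiring ℚ-rawSemiring using () renaming (_^_ to _^ℚ_)

  <+⇒-< : ∀ x u v → x <ℚ u +ℚ v → x -ℚ u <ℚ v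
  <+⇒-< x u v lt = ℚ.<-respʳ-≃ (cancel u v) (ℚ.+-monoˡ-< (-ℚ u) lt)
    where
    open +-*-Solver
    cancel : ∀ u v → (u +ℚ v) -ℚ u ≃ℚ v
    cancel = solve 2 (λ u v → (u :+ v) :- u := v) ℚ.≃-refl

  u+[x-u]≃x : ∀ x u → u +ℚ (x -ℚ u) ≃ℚ x
  u+[x-u]≃x = solve 2 (λ x u → u :+ (x :- u) := x) ℚ.≃-refl
    where open +-*-Solver

  suc-/1 : ∀ p → + suc p /ℚ 1 ≃ℚ (+ 1 /ℚ 1) +ℚ (+ p /ℚ 1)
  suc-/1 p = ℚ.≃-reflexive (cong (λ i → mkℚᵘ i 0) (sym (cong (λ i → + 1 ℤ.+ i) (ℤ.*-identityʳ (+ p)))))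

  -- All p summands use the same a, and the final cut of 0 takes up the negative difference b - p a.
  ·-cut : ∀ p {x : ℝ} {a b} → x a → b <ℚ (+ p /ℚ 1) *ℚ a → (p · x) b
  ·-cut zero {a = a} xa lt = ℚ.<-respʳ-≃ (ℚ.*-zeroˡ a) lt
  ·-cut (suc p) {x} {a} {b} xa lt =
    a , b -ℚ a , xa , ·-cut p xa (<+⇒-< b a _ (ℚ.<-respʳ-≃ (ℚ.≃-trans (ℚ.*-cong {x = + suc p /ℚ 1} {u = a} (suc-/1 p) ℚ.≃-refl) (expand a (+ p /ℚ 1))) lt)) , ℚ.≤-reflexive (ℚ.≃-sym (u+[x-u]≃x b a))
    where
    open +-*-Solver
    expand : ∀ a p → ((+ 1 /ℚ 1) +ℚ p) *ℚ a ≃ℚ a +ℚ p *ℚ a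
    expand = solve 2 (λ a p → (con (+ 1 /ℚ 1) :+ p) :* a := a :+ p :* a) ℚ.≃-refl

  -- If n < c + p a, density leaves room to write n as a sum of an element below c and one below p
  -- a. So n lies in the cut on the right, hence in its own open cut, which is absurd.
  cut-≤ : ∀ {n c p x a} → fromℕ n ≥ℝ fromℕ c +ℝ p · x → x a → (+ c /ℚ 1) +ℚ (+ p /ℚ 1) *ℚ a ≤ℚ + n /ℚ 1
  cut-≤ {n} {c} {p} {x} {a} n≥ xa = ℚ.≮⇒≥ λ n< →
    let b , n-c<b , b<pa = ℚ.<-dense (<+⇒-< (+ n /ℚ 1) (+ c /ℚ 1) _ n<)
        n-b<c = <+⇒-< (+ n /ℚ 1) b (+ c /ℚ 1) (ℚ.<-respʳ-≃ (ℚ.+-comm (+ c /ℚ 1) b)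
                  (ℚ.<-respˡ-≃ (u+[x-u]≃x (+ n /ℚ 1) (+ c /ℚ 1)) (ℚ.+-monoʳ-< (+ c /ℚ 1) n-c<b)))
    in ℚ.<-irrefl ℚ.≃-refl (n≥ (+ n /ℚ 1) (_ , b , n-b<c , ·-cut p xa b<pa ,
         ℚ.≤-reflexive (ℚ.≃-trans (ℚ.≃-sym (u+[x-u]≃x (+ n /ℚ 1) b)) (ℚ.+-comm b _))))

  cut-≤ℕ : ∀ {n c p x A d} → fromℕ n ≥ℝ fromℕ c +ℝ p · x → x (mkℚᵘ (+ A) d) → c * suc d + p * A ≤ n * suc d
  cut-≤ℕ {n} {c} {p} {x} {A} {d} n≥ xa = ℤ.drop‿+≤+ (subst₂ ℤ._≤_ lhs rhs (ℚ.drop-*≤* (cut-≤ {n} {c} {p} n≥ xa)))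
    where
    D = suc d
    lhs : (+ c ℤ.* + (1 * D) ℤ.+ (+ p ℤ.* + A) ℤ.* + 1) ℤ.* + 1 ≡ + (c * D + p * A)
    lhs = trans (ℤ.*-identityʳ _) (cong₂ ℤ._+_
      (trans (sym (ℤ.pos-* c (1 * D))) (cong (λ x → + (c * x)) (*-identityˡ D)))
      (trans (ℤ.*-identityʳ _) (sym (ℤ.pos-* p A))))
    rhs : + n ℤ.* + (1 * (1 * D)) ≡ + (n * D)
    rhs = trans (sym (ℤ.pos-* n (1 * (1 * D)))) (cong (λ x → + (n * x)) (trans (*-identityˡ (1 * D)) (*-identityˡ D)))

  ^-/1 : ∀ r p → (+ r /ℚ 1) ^ℚ p ≡ + (r ^ p) /ℚ 1
  ^-/1 r zero = refl
  ^-/1 r (suc p) = trans (cong ((+ r /ℚ 1) *ℚ_) (^-/1 r p)) (cong (λ i → mkℚᵘ i 0) (sym (ℤ.pos-* r (r ^ p))))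

  /1-mono-< : ∀ {a b} → a < b → + a /ℚ 1 <ℚ + b /ℚ 1
  /1-mono-< {a} {b} lt = *<* (subst₂ ℤ._<_ (sym (ℤ.*-identityʳ (+ a))) (sym (ℤ.*-identityʳ (+ b))) (ℤ.+<+ lt))

  log₂-cut : ∀ {x r A d} → x (+ suc r /ℚ 1) → 2 ^ A < suc r ^ suc d → log₂ x (mkℚᵘ (+ A) d)
  log₂-cut {r = r} {A} {d} xr lt = + suc r /ℚ 1 , xr , /1-mono-< z<s ,
    subst (+ (2 ^ A) /ℚ 1 <ℚ_) (sym (^-/1 (suc r) (suc d))) (/1-mono-< lt)

  -- 13/5 < 1 + 1 + 1/2 + 1/6 < e, and 2k · 13/5 > 5k + 1/2 for k ≥ 3.
  5k+1-cut : ∀ k → 3 ≤ k → ((2 * k) · e +ℝ fromℕ 1) (+ suc (5 * k) /ℚ 1)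
  5k+1-cut k 3≤k = mkℚᵘ (+ (10 * k + 1)) 1 , mkℚᵘ (+ 1) 1 ,
    ·-cut (2 * k) {e} {mkℚᵘ (+ 13) 4} (3 , from-yes (mkℚᵘ (+ 13) 4 ℚ.<? expSum 3)) (*<* (subst₂ ℤ._<_ (ℤ.pos-* (10 * k + 1) 5) rhs (ℤ.+<+ room))) ,
    from-yes (mkℚᵘ (+ 1) 1 ℚ.<? (+ 1 /ℚ 1)) ,
    ℚ.≤-reflexive (ℚ.≃-sym (*≡* sums))
    where
    rhs : + (2 * k * 13 * 2) ≡ (+ (2 * k) ℤ.* + 13) ℤ.* + 2
    rhs = trans (ℤ.pos-* (2 * k * 13) 2) (cong (ℤ._* + 2) (ℤ.pos-* (2 * k) 13))
    room : (10 * k + 1) * 5 < 2 * k * 13 * 2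
    room = begin-strict
      (10 * k + 1) * 5 ≡⟨ expand₁ k ⟩
      50 * k + 5       <⟨ +-monoʳ-< (50 * k) (*-monoʳ-≤ 2 3≤k) ⟩
      50 * k + 2 * k   ≡⟨ expand₂ k ⟩
      2 * k * 13 * 2   ∎
      where
      open ≤-Reasoning
      expand₁ : ∀ k → (10 * k + 1) * 5 ≡ 50 * k + 5
      expand₁ = solve-∀
      expand₂ : ∀ k → 50 * k + 2 * k ≡ 2 * k * 13 * 2
      expand₂ = solve-∀
    sums : (+ (10 * k + 1) ℤ.* + 2 ℤ.+ + 1 ℤ.* + 2) ℤ.* + 1 ≡ + suc (5 * k) ℤ.* + 4
    sums = trans (ℤ.*-identityʳ _) (trans (cong (ℤ._+ + 2) (sym (ℤ.pos-* (10 * k + 1) 2)))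
      (trans (cong +_ (expand k)) (ℤ.pos-* (suc (5 * k)) 4)))
      where
      expand : ∀ k → (10 * k + 1) * 2 + 2 ≡ suc (5 * k) * 4
      expand = solve-∀

  -- If a < b then 2 a^J < b^J for J = a + 1.
  double-power : ∀ a b → 1 ≤ a → a < b → 2 * a ^ suc a < b ^ suc a
  double-power a b 1≤a a<b = begin-strict
    2 * a ^ suc a               <⟨ m<m+n (2 * a ^ suc a) (m^n>0 a {{>-nonZero 1≤a}} a) ⟩
    2 * (a * a ^ a) + a ^ a     ≡⟨ expand a (a ^ a) ⟩
    a * a ^ a + suc a * a ^ a   ≤⟨ bernoulli a a ⟩
    suc a ^ suc a               ≤⟨ ^-monoˡ-≤ (suc a) a<b ⟩
    b ^ suc a                   ∎
    where
    open ≤-Reasoning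
    expand : ∀ a x → 2 * (a * x) + x ≡ a * x + suc a * x
    expand = solve-∀

  -- If 2^m < (r + 1)^(p+1), a J-th power widens the gap to a factor 2, so the rational (m J +
  -- 1)/((p + 1) J) lies below log₂ x. Multiplied by p + 1 it exceeds m, contrary to `cut-≤ℕ`.
  integral-bound : ∀ {n c x r} p → fromℕ n ≥ℝ fromℕ c +ℝ suc p · log₂ x → x (+ suc r /ℚ 1) → 2 ≤ r →
                   ∃ λ m → n ≡ c + m × suc r ^ suc p ≤ 2 ^ m
  integral-bound {n} {c} {x} {r} p n≥ xr 2≤r = m , sym (m+[n∸m]≡n c≤n) , ≮⇒≥ impossible
    where
    m = n ∸ c
    c≤n : c ≤ n
    -- As 2 < r + 1, the rational 1 lies below log₂ x; this makes n ∸ c a true difference.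
    c≤n = ≤-trans (m≤m+n c _) (subst₂ (λ a b → a + suc p * 1 ≤ b) (*-identityʳ c) (*-identityʳ n)
      (cut-≤ℕ {n} {c} {suc p} n≥ (log₂-cut {r = r} {1} {0} xr (≤-trans (s≤s 2≤r) (≤-reflexive (sym (*-identityʳ (suc r))))))))
    impossible : ¬ (2 ^ m < suc r ^ suc p)
    impossible lt = <⇒≱ (m<m+n (n * D) {suc p} z<s) (begin
      n * D + suc p                       ≡⟨ cong (λ n → n * D + suc p) (m+[n∸m]≡n c≤n) ⟨
      (c + m) * D + suc p                 ≡⟨ regroup c m (suc p) J ⟩
      c * D + suc p * (m * J + 1)         ≤⟨ cut-≤ℕ {n} {c} {suc p} n≥ (log₂-cut {r = r} {m * J + 1} {pred D} xr power) ⟩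
      n * D                               ∎)
      where
      open ≤-Reasoning
      -- The exponent that `double-power` requires for a = 2^m.
      J = suc (2 ^ m)
      D = suc p * J
      regroup : ∀ c m p J → (c + m) * (p * J) + p ≡ c * (p * J) + p * (m * J + 1)
      regroup = solve-∀
      power : 2 ^ (m * J + 1) < suc r ^ D
      power = begin-strict
        2 ^ (m * J + 1)       ≡⟨ cong (2 ^_) (+-comm (m * J) 1) ⟩
        2 * 2 ^ (m * J)       ≡⟨ cong (2 *_) (^-*-assoc 2 m J) ⟨
        2 * (2 ^ m) ^ J       <⟨ double-power (2 ^ m) (suc r ^ suc p) (m^n>0 2 m) lt ⟩
        (suc r ^ suc p) ^ J   ≡⟨ ^-*-assoc (suc r) (suc p) J ⟩
        suc r ^ D             ∎

-- Intersecting families of sets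

module SetFamilies {B : Set} (_≟_ : DecidableEquality B) where
  open DecMembership _≟_ using (_∈?_)

  infixl 7 _⋒_ _∖_ _-_

  _⋒_ _∖_ : List B → List B → List B
  X ⋒ U = filter (_∈? U) X
  X ∖ U = filter (λ x → ¬? (x ∈? U)) X

  _-_ : List B → B → List B
  X - x = filter (λ z → ¬? (z ≟ x)) X

  infix 4 _⊆?_
  _⊆?_ : ∀ X Y → Dec (X ⊆ Y)
  X ⊆? Y = map′ (λ a {x} → All.lookup a) All.tabulate (all? (_∈? Y) X)

  ⊈⇒∃ : ∀ {X Y} → ¬ (X ⊆ Y) → ∃ λ x → x ∈ X × x ∉ Y
  ⊈⇒∃ {X} {Y} ⊈ with any? (λ x → ¬? (x ∈? Y)) X
  ... | yes a = let x , x∈ , x∉ = find a in x , x∈ , x∉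
  ... | no ¬a = contradiction
    (λ {x} x∈ → decidable-stable (x ∈? Y) λ x∉ → ¬a (lose x∈ x∉)) ⊈

  ∈-⋒⁺ : ∀ {X U x} → x ∈ X → x ∈ U → x ∈ X ⋒ U
  ∈-⋒⁺ {U = U} = ∈-filter⁺ (_∈? U)

  ∈-⋒⁻ : ∀ X U {x} → x ∈ X ⋒ U → x ∈ X × x ∈ U
  ∈-⋒⁻ X U = ∈-filter⁻ (_∈? U) {xs = X}

  ∈-∖⁺ : ∀ {X U x} → x ∈ X → x ∉ U → x ∈ X ∖ U
  ∈-∖⁺ {U = U} = ∈-filter⁺ (λ x → ¬? (x ∈? U))

  ∈-∖⁻ : ∀ X U {x} → x ∈ X ∖ U → x ∈ X × x ∉ U
  ∈-∖⁻ X U = ∈-filter⁻ (λ x → ¬? (x ∈? U)) {xs = X}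

  ∈-minus⁺ : ∀ {X x z} → z ∈ X → z ≢ x → z ∈ X - x
  ∈-minus⁺ {x = x} = ∈-filter⁺ (λ z → ¬? (z ≟ x))

  ∈-minus⁻ : ∀ X x {z} → z ∈ X - x → z ∈ X × z ≢ x
  ∈-minus⁻ X x = ∈-filter⁻ (λ z → ¬? (z ≟ x)) {xs = X}

  unique-⋒ : ∀ {X} U → UniqueList X → UniqueList (X ⋒ U)
  unique-⋒ U = Unique.filter⁺ (_∈? U)

  unique-∖ : ∀ {X} U → UniqueList X → UniqueList (X ∖ U)
  unique-∖ U = Unique.filter⁺ (λ x → ¬? (x ∈? U))

  unique-minus : ∀ {X} x → UniqueList X → UniqueList (X - x)
  unique-minus x = Unique.filter⁺ (λ z → ¬? (z ≟ x))

  unique-∷ : ∀ {x : B} {X} → x ∉ X → UniqueList X → UniqueList (x ∷ X)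
  unique-∷ x∉ u = All.tabulate (λ { z∈ refl → x∉ z∈ }) ∷ u

  length-⋒-∖ : ∀ X U → length (X ⋒ U) + length (X ∖ U) ≡ length X
  length-⋒-∖ X U = length-filter-¬ (_∈? U) X

  length-minus-≤ : ∀ X x → UniqueList X → length X ≤ suc (length (X - x))
  length-minus-≤ X x u = ⊆⇒length≤ u λ {z} z∈ → cover z z∈ (z ≟ x)
    where
    cover : ∀ z → z ∈ X → Dec (z ≡ x) → z ∈ x ∷ (X - x)
    cover z z∈ (yes e) = here e
    cover z z∈ (no ne) = there (∈-minus⁺ z∈ ne)

  length-minus-< : ∀ {X x} → UniqueList X → x ∈ X → length (X - x) < length X
  length-minus-< {X} {x} u x∈ = ⊆⇒length≤
    (unique-∷ (λ p → proj₂ (∈-minus⁻ X x p) refl) (unique-minus x u))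
    λ { (here refl) → x∈ ; (there p) → proj₁ (∈-minus⁻ X x p) }

  ⋒-mono-≤ : ∀ {X Y U V} → UniqueList X → (∀ {x} → x ∈ X → x ∈ U → x ∈ Y × x ∈ V) →
             length (X ⋒ U) ≤ length (Y ⋒ V)
  ⋒-mono-≤ {X} {Y} {U} {V} u f = ⊆⇒length≤ (unique-⋒ U u) λ p →
    let x∈X , x∈U = ∈-⋒⁻ X U p ; x∈Y , x∈V = f x∈X x∈U in ∈-⋒⁺ x∈Y x∈V

  ⋒-witness : ∀ {T U Z} → UniqueList T → length (Z ⋒ U) < length (T ⋒ U) →
              ∃ λ y → y ∈ T × y ∈ U × y ∉ Z
  ⋒-witness {T} {U} {Z} u lt with ⊈⇒∃ {T ⋒ U} {Z ⋒ U} (λ sub → <⇒≱ lt (⊆⇒length≤ (unique-⋒ U u) sub))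
  ... | y , y∈ , y∉ = let y∈T , y∈U = ∈-⋒⁻ T U y∈ in y , y∈T , y∈U , λ y∈Z → y∉ (∈-⋒⁺ y∈Z y∈U)

  Intersects : ℕ → List (List B) → Set
  Intersects t 𝒯 = ∀ {T U} → T ∈ 𝒯 → U ∈ 𝒯 → t ≤ length (T ⋒ U)

  -- U may be T itself; this is how a set of exactly t elements resists removal.
  Critical : ℕ → List (List B) → Set
  Critical t 𝒯 = ∀ {T x} → T ∈ 𝒯 → x ∈ T → ∃ λ U → U ∈ 𝒯 × length ((T - x) ⋒ U) < t

  Covers : List (List B) → List B → Set
  Covers 𝓛 T = Any (_⊆ T) 𝓛

  record Sets (t q : ℕ) (𝒯 : List (List B)) : Set where
    field
      unique     : ∀ {T} → T ∈ 𝒯 → UniqueList T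
      bounded    : ∀ {T} → T ∈ 𝒯 → length T ≤ q
      intersects : Intersects t 𝒯
  open Sets

  totalSize : List (List B) → ℕ
  totalSize 𝒯 = sum (map length 𝒯)

  totalSize-insert : ∀ 𝒰 {𝒱 T} → totalSize (𝒰 ++ T ∷ 𝒱) ≡ length T + totalSize (𝒰 ++ 𝒱)
  totalSize-insert [] = refl
  totalSize-insert (U ∷ 𝒰) {𝒱} {T} = begin
    length U + totalSize (𝒰 ++ T ∷ 𝒱)           ≡⟨ cong (length U +_) (totalSize-insert 𝒰) ⟩
    length U + (length T + totalSize (𝒰 ++ 𝒱)) ≡⟨ swap-sum (length U) (length T) (totalSize (𝒰 ++ 𝒱)) ⟩
    length T + (length U + totalSize (𝒰 ++ 𝒱)) ∎
    where
    open ≡-Reasoning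
    swap-sum : ∀ a b c → a + (b + c) ≡ b + (a + c)
    swap-sum = solve-∀

  ∈-insert⁻ : ∀ {A : Set} us {vs : List A} {x z} → z ∈ us ++ x ∷ vs → z ≡ x ⊎ z ∈ us ++ vs
  ∈-insert⁻ us {vs} {x} z∈ with Any-resp-↭ (shift x us vs) z∈
  ... | here e = inj₁ e
  ... | there p = inj₂ p

  ∈-insert⁺ : ∀ {A : Set} us {vs : List A} {x z} → z ∈ us ++ vs → z ∈ us ++ x ∷ vs
  ∈-insert⁺ us {vs} {x} z∈ = Any-resp-↭ (↭-sym (shift x us vs)) (there z∈)

  module _ {t q : ℕ} where

    -- Elements are removed one at a time as long as the family stays t-intersecting. The total size
    -- decreases, and each original set keeps a subset in the new family.
    criticalise : ∀ fuel 𝒯 → totalSize 𝒯 ≤ fuel → Sets t q 𝒯 →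
      ∃ λ 𝒯′ → Sets t q 𝒯′ × Critical t 𝒯′ × (∀ {T} → T ∈ 𝒯 → Covers 𝒯′ T)
    criticalise fuel 𝒯 le S
      with any? (λ T → any? (λ x → all? (λ U → t ≤? length ((T - x) ⋒ U)) 𝒯) T) 𝒯
    ... | no none = 𝒯 , S , crit , λ T∈ → lose T∈ id
      where
      crit : Critical t 𝒯
      crit {T} {x} T∈ x∈ with any? (λ U → length ((T - x) ⋒ U) <? t) 𝒯
      ... | yes a = find a
      ... | no ¬a = contradiction (lose T∈ (lose x∈ (All.map ≮⇒≥ (All.¬Any⇒All¬ 𝒯 ¬a)))) none
    ... | yes some with find some
    ... | T , T∈ , some′ with find some′
    ... | x , x∈ , big with ∈-∃++ T∈
    criticalise zero .(𝒰 ++ T ∷ 𝒱) le S | yes _ | T , _ , _ | x , x∈ , _ | 𝒰 , 𝒱 , refl =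
      contradiction (≤-trans (∈-length x∈) (≤-trans (m≤m+n _ _) (≤-trans (≤-reflexive (sym (totalSize-insert 𝒰))) le))) λ ()
    criticalise (suc fuel) .(𝒰 ++ T ∷ 𝒱) le S | yes _ | T , T∈ , _ | x , x∈ , big | 𝒰 , 𝒱 , refl
      with criticalise fuel ((T - x) ∷ 𝒰 ++ 𝒱) smaller
             (record { unique = uniq ; bounded = bnd ; intersects = int })
      where
      uT = unique S T∈
      smaller : length (T - x) + totalSize (𝒰 ++ 𝒱) ≤ fuel
      smaller = s≤s⁻¹ (≤-trans (+-monoˡ-≤ _ (length-minus-< uT x∈))
                        (≤-trans (≤-reflexive (sym (totalSize-insert 𝒰))) le))
      uniq : ∀ {V} → V ∈ (T - x) ∷ 𝒰 ++ 𝒱 → UniqueList V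
      uniq (here refl) = unique-minus x uT
      uniq (there p) = unique S (∈-insert⁺ 𝒰 p)
      bnd : ∀ {V} → V ∈ (T - x) ∷ 𝒰 ++ 𝒱 → length V ≤ q
      bnd (here refl) = ≤-trans (<⇒≤ (length-minus-< uT x∈)) (bounded S T∈)
      bnd (there p) = bounded S (∈-insert⁺ 𝒰 p)
      int : Intersects t ((T - x) ∷ 𝒰 ++ 𝒱)
      -- T was among the sets tested against T - x, which gives |T - x| ≥ t.
      int (here refl) (here refl) = ≤-trans (All.lookup big T∈)
        (⋒-mono-≤ (unique-minus x uT) λ p _ → p , p)
      int (here refl) (there p) = All.lookup big (∈-insert⁺ 𝒰 p)
      int (there p) (here refl) = ≤-trans (All.lookup big (∈-insert⁺ 𝒰 p))
        (⋒-mono-≤ (unique-minus x uT) λ a b → b , a)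
      int (there p) (there p′) = intersects S (∈-insert⁺ 𝒰 p) (∈-insert⁺ 𝒰 p′)
    ... | 𝒯′ , S′ , crit , cov = 𝒯′ , S′ , crit , cov′
      where
      cov′ : ∀ {V} → V ∈ 𝒰 ++ T ∷ 𝒱 → Covers 𝒯′ V
      cov′ V∈ with ∈-insert⁻ 𝒰 V∈
      ... | inj₁ refl = Any.map (λ sub {z} z∈ → proj₁ (∈-minus⁻ T x (sub z∈))) (cov (here refl))
      ... | inj₂ p = cov (there p)

  gather : {I : Set} (is : List I) (c : ℕ) (P : List B → Set) (Q : I → List B → Set) →
    (∀ {i} → i ∈ is → ∃ λ 𝓛 → length 𝓛 ≤ c × All P 𝓛 × (∀ {T} → Q i T → Covers 𝓛 T)) →
    ∃ λ 𝓛 → length 𝓛 ≤ length is * c × All P 𝓛 × (∀ {T} → Any (λ i → Q i T) is → Covers 𝓛 T)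
  gather [] c P Q f = [] , z≤n , [] , λ ()
  gather (i ∷ is) c P Q f with f (here refl) | gather is c P Q (f ∘ there)
  ... | 𝓛 , le , a , cov | 𝓛′ , le′ , a′ , cov′ =
    𝓛 ++ 𝓛′ , ≤-trans (≤-reflexive (length-++ 𝓛)) (+-mono-≤ le le′) , All.++⁺ a a′ ,
    λ { (here q) → Any.++⁺ˡ (cov q) ; (there q) → Any.++⁺ʳ 𝓛 (cov′ q) }

  -- Covering the largest sets of a critical family

  module Layer {t s : ℕ} {𝒯 : List (List B)} (S : Sets t (t + s) 𝒯) (crit : Critical t 𝒯) where

    Full : List B → Set
    Full L = UniqueList L × length L ≡ t + s

    Target : List B → List B → Set
    Target X T = T ∈ 𝒯 × length T ≡ t + s × X ⊆ T

    -- If |U ∩ X| < t ≤ |U ∩ T| and X ⊆ T, then T misses at most s elements of U,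
    -- so it meets every set of s + 1 elements of U ∖ X.
    meets : ∀ {X U T} → UniqueList X → U ∈ 𝒯 → T ∈ 𝒯 → length (X ⋒ U) < t →
            Any (_∈ T) (take (suc s) (U ∖ X))
    meets {X} {U} {T} uX U∈ T∈ small with any? (_∈? T) (take (suc s) (U ∖ X))
    ... | yes a = a
    ... | no ¬a = contradiction (intersects S T∈ U∈) (<⇒≱ (≤-<-trans bound₁ bound₂))
      where
      uU = unique S U∈
      rest = drop (suc s) (U ∖ X)
      inside-or-rest : T ⋒ U ⊆ (U ⋒ X) ++ rest
      inside-or-rest {z} z∈ with ∈-⋒⁻ T U z∈
      ... | z∈T , z∈U with z ∈? X
      ... | yes z∈X = ∈-++⁺ˡ (∈-⋒⁺ z∈U z∈X)
      ... | no z∉X with ∈-++⁻ (take (suc s) (U ∖ X)) (subst (z ∈_) (sym (take++drop≡id (suc s) (U ∖ X))) (∈-∖⁺ z∈U z∉X))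
      ... | inj₁ p = contradiction (lose p z∈T) ¬a
      ... | inj₂ p = ∈-++⁺ʳ (U ⋒ X) p
      bound₁ : length (T ⋒ U) ≤ length (U ⋒ X) + (length (U ∖ X) ∸ suc s)
      bound₁ = ≤-trans (⊆⇒length≤ (unique-⋒ U (unique S T∈)) inside-or-rest)
        (≤-reflexive (trans (length-++ (U ⋒ X)) (cong (length (U ⋒ X) +_) (length-drop (suc s) (U ∖ X)))))
      few : length (U ⋒ X) < t
      few = ≤-<-trans (⋒-mono-≤ uU λ a b → b , a) small
      bound₂ : length (U ⋒ X) + (length (U ∖ X) ∸ suc s) < t
      bound₂ with suc s ≤? length (U ∖ X)
      -- U ∖ X has at most s elements, so `rest` is empty and T ∩ U would lie in U ∩ X.
      ... | no ≰ = subst (_< t) (sym (trans (cong (length (U ⋒ X) +_) (m≤n⇒m∸n≡0 (<⇒≤ (≰⇒> ≰)))) (+-identityʳ _))) few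
      ... | yes le = +-cancelʳ-≤ s _ t (begin
        suc (length (U ⋒ X) + (length (U ∖ X) ∸ suc s)) + s  ≡⟨ rearrange (length (U ⋒ X)) _ s ⟩
        length (U ⋒ X) + ((length (U ∖ X) ∸ suc s) + suc s)  ≡⟨ cong (length (U ⋒ X) +_) (m∸n+n≡m le) ⟩
        length (U ⋒ X) + length (U ∖ X)                      ≡⟨ length-⋒-∖ U X ⟩
        length U                                             ≤⟨ bounded S U∈ ⟩
        t + s                                                ∎)
        where
        open ≤-Reasoning
        rearrange : ∀ a b c → suc (a + b) + c ≡ a + (b + suc c)
        rearrange = solve-∀

    -- Let T₀ be a target and x ∈ T₀ ∖ X. Criticality yields U with |(T₀ - x) ∩ U| < t, hence |X ∩
    -- U| < t as X ⊆ T₀ - x. By `meets`, every target then contains z ∷ X for one of at most s + 1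
    -- elements z; d counts the elements still to be added.
    branch : ∀ d X → UniqueList X → length X + d ≡ t + s →
      ∃ λ 𝓛 → length 𝓛 ≤ suc s ^ d × All Full 𝓛 × (∀ {T} → Target X T → Covers 𝓛 T)
    branch zero X u e = [ X ] , ≤-refl , (u , trans (sym (+-identityʳ _)) e) ∷ [] , λ { (_ , _ , sub) → here sub }
    branch (suc d) X u e with any? (λ T → (length T ℕ.≟ t + s) ×-dec (X ⊆? T)) 𝒯
    ... | no none = [] , z≤n , [] , λ { (T∈ , l , sub) → contradiction (lose T∈ (l , λ {z} → sub {z})) none }
    ... | yes some with find some
    ... | T₀ , T₀∈ , l₀ , sub₀
      with ⊈⇒∃ {T₀} {X} (λ sub → <⇒≱ (≤-trans (s≤s (m≤m+n _ d)) (≤-reflexive (trans (sym (+-suc _ d)) (trans e (sym l₀)))))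
                                   (⊆⇒length≤ (unique S T₀∈) sub))
    ... | x , x∈ , x∉ with crit T₀∈ x∈
    ... | U , U∈ , small = result
      where
      small′ : length (X ⋒ U) < t
      small′ = ≤-<-trans (⋒-mono-≤ u λ z∈X z∈U → ∈-minus⁺ (sub₀ z∈X) (λ { refl → x∉ z∈X }) , z∈U) small
      Z = take (suc s) (U ∖ X)
      Z⊆ : Z ⊆ U ∖ X
      Z⊆ {z} z∈ = subst (z ∈_) (take++drop≡id (suc s) (U ∖ X)) (∈-++⁺ˡ z∈)
      next = gather Z (suc s ^ d) Full (λ z → Target (z ∷ X)) λ {z} z∈ →
        branch d (z ∷ X) (unique-∷ (proj₂ (∈-∖⁻ U X (Z⊆ z∈))) u) (trans (sym (+-suc _ d)) e)
      result : ∃ λ 𝓛 → length 𝓛 ≤ suc s ^ suc d × All Full 𝓛 × (∀ {T} → Target X T → Covers 𝓛 T)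
      result = let 𝓛 , le , full , cov = next in
        𝓛 ,
        ≤-trans le (*-monoˡ-≤ (suc s ^ d) (≤-trans (≤-reflexive (length-take (suc s) (U ∖ X))) (m⊓n≤m (suc s) _))) ,
        full ,
        λ { (T∈ , l , sub) → cov (Any.map (λ z∈ → T∈ , l , λ { (here refl) → z∈ ; (there p) → sub p }) (meets u U∈ T∈ small′)) }

    -- Any member U of full size serves as the root: every other T meets it in t elements, so T
    -- contains one of the t-subsets of U, where the branching starts.
    top : ∃ λ 𝓛 → length 𝓛 ≤ ((t + s) C s) * suc s ^ s × All Full 𝓛 ×
                  (∀ {T} → T ∈ 𝒯 → length T ≡ t + s → Covers 𝓛 T)
    top with any? (λ T → length T ℕ.≟ t + s) 𝒯
    ... | no none = [] , z≤n , [] , λ T∈ l → contradiction (lose T∈ l) none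
    ... | yes some with find some
    ... | U , U∈ , l = let 𝓛 , le , full , cov = all in
      𝓛 , ≤-trans le (≤-reflexive (cong (_* suc s ^ s) (trans (length-omit s U) (cong (_C s) l)))) , full ,
      λ {T} T∈ lT → cov (Any.map (λ a → T∈ , lT , λ {z} → All.lookup a)
        (omit-covers (_∈? T) t s U l (≤-trans (intersects S T∈ U∈) (⋒-mono-≤ (unique S T∈) λ a b → b , a))))
      where
      all = gather (omit s U) (suc s ^ s) Full Target λ {X} X∈ →
        branch s X (omit-unique s U (unique S U∈) X∈) (trans (omit-size s U X∈) l)

  ⋒-full : ∀ {X U} → UniqueList X → length X ≤ length (X ⋒ U) → X ⊆ U
  ⋒-full {X} {U} u le {x} x∈ = decidable-stable (x ∈? U) λ x∉ →
    <⇒≱ (length-minus-< u x∈) (≤-trans le (⊆⇒length≤ (unique-⋒ U u) λ z∈ →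
      let z∈X , z∈U = ∈-⋒⁻ X U z∈ in ∈-minus⁺ z∈X λ { refl → x∉ z∈U }))

  ⋒-size : ∀ {t q 𝒯 T} → Sets t q 𝒯 → T ∈ 𝒯 → t ≤ length T
  ⋒-size {T = T} S T∈ = ≤-trans (intersects S T∈ T∈) (length-filter (_∈? T) T)

  -- Peeling off the layers

  module Peeling (t k : ℕ) (g : ℕ → ℕ) where
    open Budget t k g

    cost : List (List B) → ℕ
    cost 𝒲 = sum (map (λ W → g (length W ∸ t)) 𝒲)

    cost-++ : ∀ 𝒱 𝒲 → cost (𝒱 ++ 𝒲) ≡ cost 𝒱 + cost 𝒲
    cost-++ [] 𝒲 = refl
    cost-++ (V ∷ 𝒱) 𝒲 = trans (cong (_ +_) (cost-++ 𝒱 𝒲)) (sym (+-assoc _ (cost 𝒱) (cost 𝒲)))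

    cost-uniform : ∀ s 𝒲 → All (λ W → length W ≡ t + s) 𝒲 → cost 𝒲 ≡ length 𝒲 * g s
    cost-uniform s [] [] = refl
    cost-uniform s (W ∷ 𝒲) (e ∷ a) =
      cong₂ _+_ (cong g (trans (cong (_∸ t) e) (m+n∸m≡n t s))) (cost-uniform s 𝒲 a)

    -- The bound t < |W| is strict because a kernel of t elements would cost g 0, which in the
    -- application is all of M.
    Kernel : ℕ → List B → Set
    Kernel s W = UniqueList W × t < length W × length W ≤ t + s

    Common : List (List B) → Set
    Common 𝒯 = ∃ λ X → UniqueList X × length X ≡ t × (∀ {T} → T ∈ 𝒯 → X ⊆ T)

    CoveredBy : ℕ → List (List B) → Set
    CoveredBy s 𝒯 = ∃ λ 𝒲 → All (Kernel s) 𝒲 × (∀ {T} → T ∈ 𝒯 → Covers 𝒲 T) × cost 𝒲 ≤ budget s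

    -- The sets of full size in the critical family go into 𝓛, and the smaller ones are peeled
    -- further. If these share a t-set X, either every set of the critical family contains X, and
    -- then so does all of 𝒯, or some U does not. In the latter case each smaller set contains X and
    -- an element of U ∖ X, and the at most k sets y ∷ X are the kernels.
    peel : ∀ s 𝒯 → t + s ≤ k → Sets t (t + s) 𝒯 → Common 𝒯 ⊎ CoveredBy s 𝒯
    peel zero [] le S = inj₂ ([] , [] , (λ ()) , z≤n)
    peel zero (T ∷ 𝒯) le S = inj₁ (T , unique S (here refl) , size ,
      λ T′∈ → ⋒-full (unique S (here refl)) (≤-trans (≤-reflexive size) (intersects S (here refl) T′∈)))
      where
      size : length T ≡ t
      size = ≤-antisym (≤-trans (bounded S (here refl)) (≤-reflexive (+-identityʳ t))) (⋒-size S (here refl))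
    peel (suc s) 𝒯 le S with criticalise (totalSize 𝒯) 𝒯 ≤-refl S
    ... | 𝒯* , S* , crit , cov* with Layer.top S* crit
    ... | 𝓛 , count , full , covTop = result (peel s small (≤-trans (+-monoʳ-≤ t (n≤1+n s)) le) Sᵣ)
      where
      small? = λ T → length T <? t + suc s
      small = filter small? 𝒯*
      small⊆ : ∀ {T} → T ∈ small → T ∈ 𝒯*
      small⊆ = proj₁ ∘ ∈-filter⁻ small? {xs = 𝒯*}
      Sᵣ : Sets t (t + s) small
      Sᵣ = record
        { unique = unique S* ∘ small⊆
        ; bounded = λ {T} T∈ → s≤s⁻¹ (≤-trans (proj₂ (∈-filter⁻ small? {xs = 𝒯*} T∈)) (≤-reflexive (+-suc t s)))
        ; intersects = λ T∈ U∈ → intersects S* (small⊆ T∈) (small⊆ U∈)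
        }
      extend : CoveredBy s small → CoveredBy (suc s) 𝒯
      extend (𝒲 , kernels , cov , cheap) =
        𝓛 ++ 𝒲 ,
        All.++⁺ (All.map (λ { (u , l) → u , ≤-trans (≤-trans (≤-reflexive (+-comm 1 t)) (+-monoʳ-≤ t (s≤s z≤n))) (≤-reflexive (sym l)) , ≤-reflexive l }) full)
                (All.map (λ { (u , l , l′) → u , l , ≤-trans l′ (+-monoʳ-≤ t (n≤1+n s)) }) kernels) ,
        (λ T∈ → let T* , T*∈ , sub = find (cov* T∈) in Any.map (λ sub′ {z} z∈ → sub (sub′ z∈)) (cover* T*∈)) ,
        (begin
          cost (𝓛 ++ 𝒲)               ≡⟨ cost-++ 𝓛 𝒲 ⟩
          cost 𝓛 + cost 𝒲             ≡⟨ cong (_+ cost 𝒲) (cost-uniform (suc s) 𝓛 (All.map proj₂ full)) ⟩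
          length 𝓛 * g (suc s) + cost 𝒲 ≤⟨ +-mono-≤ (*-monoˡ-≤ (g (suc s)) count) cheap ⟩
          layer (suc s) + budget s     ≤⟨ budget-step s le ⟩
          budget (suc s)               ∎)
        where
        open ≤-Reasoning
        cover* : ∀ {T} → T ∈ 𝒯* → Covers (𝓛 ++ 𝒲) T
        cover* {T} T∈ with length T <? t + suc s
        ... | yes lt = Any.++⁺ʳ 𝓛 (cov (∈-filter⁺ small? T∈ lt))
        ... | no ≮ = Any.++⁺ˡ (covTop T∈ (≤-antisym (bounded S* T∈) (≮⇒≥ ≮)))
      result : Common small ⊎ CoveredBy s small → Common 𝒯 ⊎ CoveredBy (suc s) 𝒯
      result (inj₂ c) = inj₂ (extend c)
      result (inj₁ (X , uX , lX , common)) with any? (λ U → ¬? (X ⊆? U)) 𝒯*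
      ... | no none = inj₁ (X , uX , lX , λ T∈ → let T* , T*∈ , sub = find (cov* T∈) in
              λ z∈ → sub (decidable-stable (X ⊆? T*) (λ ⊈ → none (lose T*∈ ⊈)) z∈))
      ... | yes some with find some
      ... | U , U∈ , X⊈U = inj₂ (extend (substitute s refl))
        where
        outside-X : ∀ {T} → T ∈ small → ∃ λ y → y ∈ T × y ∈ U × y ∉ X
        outside-X T∈ = ⋒-witness (unique S* (small⊆ T∈)) (≤-trans
          (≰⇒> λ t≤ → X⊈U (⋒-full uX (≤-trans (≤-reflexive lX) t≤)))
          (intersects S* (small⊆ T∈) U∈))
        substitute : ∀ s′ → s′ ≡ s → CoveredBy s small
        -- The smaller sets have at most t elements, no room for both X and y. So there are none,
        -- and `budget 0` pays for them.
        substitute zero refl = [] , [] , (λ T∈ → contradiction (bounded Sᵣ T∈) (too-large T∈)) , z≤n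
          where
          too-large : ∀ {T} → T ∈ small → ¬ (length T ≤ t + 0)
          too-large T∈ l with outside-X T∈
          ... | y , y∈T , y∈U , y∉X = <⇒≱ (s≤s (≤-trans l (≤-reflexive (trans (+-identityʳ t) (sym lX)))))
            (⊆⇒length≤ (unique-∷ y∉X uX) λ { (here refl) → y∈T ; (there p) → common T∈ p })
        substitute (suc s′) refl =
          map (_∷ X) (U ∖ X) ,
          All.map⁺ (All.tabulate λ y∈ → unique-∷ (proj₂ (∈-∖⁻ U X y∈)) uX , s≤s (≤-reflexive (sym lX)) ,
                      ≤-trans (≤-reflexive (trans (cong suc lX) (+-comm 1 t))) (+-monoʳ-≤ t (s≤s z≤n))) ,
          (λ T∈ → let y , y∈T , y∈U , y∉X = outside-X T∈ in
            Any.map⁺ (lose (∈-∖⁺ y∈U y∉X) λ { (here refl) → y∈T ; (there p) → common T∈ p })) ,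
          (begin
            cost (map (_∷ X) (U ∖ X))        ≡⟨ cost-uniform 1 (map (_∷ X) (U ∖ X)) (All.map⁺ (All.tabulate {xs = U ∖ X} λ _ → trans (cong suc lX) (+-comm 1 t))) ⟩
            length (map (_∷ X) (U ∖ X)) * g 1 ≡⟨ cong (_* g 1) (length-map (_∷ X) (U ∖ X)) ⟩
            length (U ∖ X) * g 1              ≤⟨ *-monoˡ-≤ (g 1) (≤-trans (length-filter _ U) (≤-trans (bounded S* U∈) le)) ⟩
            k * g 1                           ≤⟨ budget-≥ s′ ⟩
            budget (suc s′)                   ∎)
          where open ≤-Reasoning

  -- The hypothesis exchange holds for partitions: a partition T ⊇ P ∖ Q has no room for
  -- a block of Q ∖ P, as this is covered by the blocks of P ∖ Q.
  module CodimensionTwo {t : ℕ} {𝒯 : List (List B)} (S : Sets t (2 + t) 𝒯)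
    (size : ∀ {T} → T ∈ 𝒯 → length T ≡ 2 + t)
    (near : ∀ {P Q} → P ∈ 𝒯 → Q ∈ 𝒯 → t < length (P ⋒ Q) → P ⊆ Q)
    (exchange : ∀ {P Q T} → P ∈ 𝒯 → Q ∈ 𝒯 → T ∈ 𝒯 → P ∖ Q ⊆ T → ∀ {c} → c ∈ Q ∖ P → c ∉ T) where

    Kernel₁ : List B → Set
    Kernel₁ W = UniqueList W × length W ≡ suc t

    ⋒-≤ : ∀ {P Q} → P ∈ 𝒯 → Q ∈ 𝒯 → ¬ (P ⊆ Q) → length (P ⋒ Q) ≤ t
    ⋒-≤ P∈ Q∈ P⊈Q = ≮⇒≥ (P⊈Q ∘ near P∈ Q∈)

    length-∖ : ∀ {P Q} → P ∈ 𝒯 → length (P ⋒ Q) ≡ t → length (P ∖ Q) ≡ 2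
    length-∖ {P} {Q} P∈ e = +-cancelˡ-≡ t _ 2
      (trans (cong (_+ length (P ∖ Q)) (sym e)) (trans (length-⋒-∖ P Q) (trans (size P∈) (+-comm 2 t))))

    -- A member missing two elements of Y contains every further element of P ⊇ Y.
    full-outside : ∀ {P T y y′ z} → P ∈ 𝒯 → T ∈ 𝒯 → y ∈ P → y′ ∈ P → z ∈ P → y ≢ y′ → z ≢ y → z ≢ y′ →
                   y ∉ T → y′ ∉ T → z ∈ T
    full-outside {P} {T} {y} {y′} {z} P∈ T∈ y∈ y′∈ z∈ y≢y′ z≢y z≢y′ y∉ y′∉ =
      decidable-stable (z ∈? T) λ z∉ → <⇒≱
        (s≤s⁻¹ (s≤s⁻¹ (≤-trans (s≤s (s≤s (≤-<-trans (⊆⇒length≤ (unique-⋒ P (unique S T∈)) λ {x} x∈ →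
            let x∈T , x∈P = ∈-⋒⁻ T P x∈ in
            ∈-minus⁺ (∈-minus⁺ (∈-minus⁺ x∈P (λ { refl → y∉ x∈T })) (λ { refl → y′∉ x∈T })) (λ { refl → z∉ x∈T }))
          (length-minus-< u₂ (∈-minus⁺ (∈-minus⁺ z∈ z≢y) z≢y′)))))
          (≤-trans (s≤s (length-minus-< u₁ (∈-minus⁺ y′∈ (y≢y′ ∘ sym))))
            (≤-trans (length-minus-< uP y∈) (≤-reflexive (size P∈)))))))
        (intersects S T∈ P∈)
      where
      uP = unique S P∈
      u₁ = unique-minus y uP
      u₂ = unique-minus y′ u₁

    module _ {P Q V : List B} (P∈ : P ∈ 𝒯) (Q∈ : Q ∈ 𝒯) (V∈ : V ∈ 𝒯) (P⊈Q : ¬ (P ⊆ Q)) (Y⊈V : ¬ (P ⋒ Q ⊆ V)) where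

      private
        Y = P ⋒ Q
        uY = unique-⋒ Q (unique S P∈)
        lY : length Y ≡ t
        lY = ≤-antisym (⋒-≤ P∈ Q∈ P⊈Q) (intersects S P∈ Q∈)
        lY′ : length (Q ⋒ P) ≡ t
        lY′ = ≤-antisym (≤-trans (⋒-mono-≤ (unique S Q∈) (λ a b → b , a)) (≤-reflexive lY)) (intersects S Q∈ P∈)

        Exchanged : List B → Set
        Exchanged T = Any (λ y → Any (λ a → Any (λ c → (a ∷ c ∷ (Y - y)) ⊆ T) (Q ∖ P)) (P ∖ Q)) Y

        -- Let T miss y ∈ Y. If it missed another y′ ∈ Y, `full-outside` would force P ∖ Q and an
        -- element of Q ∖ P into T, against `exchange`. So T contains Y - y, which has only t - 1
        -- elements, and t-intersection with P and with Q supplies an element of P ∖ Q and one of Q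
        -- ∖ P.
        exchanged : ∀ {T} → T ∈ 𝒯 → ¬ (Y ⊆ T) → Exchanged T
        exchanged {T} T∈ Y⊈T with ⊈⇒∃ Y⊈T
        ... | y , y∈ , y∉ = lose y∈ (choose (any? (_∈? T) (P ∖ Q)) (any? (_∈? T) (Q ∖ P)))
          where
          y∈P = proj₁ (∈-⋒⁻ P Q y∈)
          y∈Q = proj₂ (∈-⋒⁻ P Q y∈)
          rest⊆ : (Y - y) ⊆ T
          rest⊆ {y′} y′∈ = decidable-stable (y′ ∈? T) λ y′∉ →
            let y′∈Y , y′≢y = ∈-minus⁻ Y y y′∈
                y′∈P , y′∈Q = ∈-⋒⁻ P Q y′∈Y
                P∖Q⊆T : P ∖ Q ⊆ T
                P∖Q⊆T = λ z∈ → let z∈P , z∉Q = ∈-∖⁻ P Q z∈ in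
                  full-outside P∈ T∈ y∈P y′∈P z∈P (y′≢y ∘ sym) (λ { refl → z∉Q y∈Q }) (λ { refl → z∉Q y′∈Q }) y∉ y′∉
                c , c∈ = nonempty (Q ∖ P) (length-∖ Q∈ lY′)
                c∈Q , c∉P = ∈-∖⁻ Q P c∈
            in exchange P∈ Q∈ T∈ P∖Q⊆T c∈
                 (full-outside Q∈ T∈ y∈Q y′∈Q c∈Q (y′≢y ∘ sym) (λ e → c∉P (subst (_∈ P) (sym e) y∈P)) (λ e → c∉P (subst (_∈ P) (sym e) y′∈P)) y∉ y′∉)
            where
            nonempty : ∀ (X : List B) → length X ≡ 2 → ∃ λ c → c ∈ X
            nonempty (c ∷ _) _ = c , here refl
          meets-outside : ∀ {R R′} → R ∈ 𝒯 → (∀ {x} → x ∈ R → x ∈ R′ → x ∈ Y) → ¬ ¬ Any (_∈ T) (R ∖ R′)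
          meets-outside {R} {R′} R∈ meet⊆ none = <⇒≱ (≤-trans (length-minus-< uY y∈) (≤-reflexive lY))
            (≤-trans (intersects S T∈ R∈) (⊆⇒length≤ (unique-⋒ R (unique S T∈)) λ {x} x∈ →
              let x∈T , x∈R = ∈-⋒⁻ T R x∈ in
              ∈-minus⁺ (meet⊆ x∈R (decidable-stable (x ∈? R′) λ x∉ → none (lose (∈-∖⁺ x∈R x∉) x∈T)))
                       (λ { refl → y∉ x∈T })))
          choose : Dec (Any (_∈ T) (P ∖ Q)) → Dec (Any (_∈ T) (Q ∖ P)) →
                   Any (λ a → Any (λ c → (a ∷ c ∷ (Y - y)) ⊆ T) (Q ∖ P)) (P ∖ Q)
          choose (no ¬a) _ = contradiction ¬a (meets-outside P∈ ∈-⋒⁺)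
          choose _ (no ¬c) = contradiction ¬c (meets-outside Q∈ (λ a b → ∈-⋒⁺ b a))
          choose (yes a) (yes c) = Any.map (λ a∈ → Any.map (λ c∈ →
            λ { (here refl) → a∈ ; (there (here refl)) → c∈ ; (there (there p)) → rest⊆ p }) c) a

      -- Members containing Y have a further element of V, which accounts for at most 2 + t kernels.
      -- For the others there are t choices of y and two each of a and c.
      few-kernels : ∃ λ 𝒲 → All Kernel₁ 𝒲 × (∀ {T} → T ∈ 𝒯 → Covers 𝒲 T) × length 𝒲 ≤ 2 + t + t * 4
      few-kernels =
        let 𝒰 , le , kernels , cov = exchanges in
        map (_∷ Y) (V ∖ Y) ++ 𝒰 ,
        All.++⁺ (All.map⁺ (All.tabulate λ v∈ → unique-∷ (proj₂ (∈-∖⁻ V Y v∈)) uY , cong suc lY)) kernels ,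
        (λ {T} T∈ → cover cov T∈ (Y ⊆? T)) ,
        ≤-trans (≤-reflexive (length-++ (map (_∷ Y) (V ∖ Y))))
          (+-mono-≤ (≤-trans (≤-reflexive (length-map (_∷ Y) (V ∖ Y))) (≤-trans (length-filter _ V) (≤-reflexive (size V∈))))
                    (≤-trans le (*-monoˡ-≤ 4 (≤-reflexive lY))))
        where
        exchanges : ∃ λ 𝒰 → length 𝒰 ≤ length Y * 4 × All Kernel₁ 𝒰 × (∀ {T} → Exchanged T → Covers 𝒰 T)
        exchanges = gather Y 4 Kernel₁ _ λ {y} y∈ →
          let 𝒰 , le , ks , cov = gather (P ∖ Q) 2 Kernel₁ _ λ {a} a∈ →
                let 𝒰 , le , ks , cov = gather (Q ∖ P) 1 Kernel₁ (λ c T → (a ∷ c ∷ (Y - y)) ⊆ T) λ {c} c∈ →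
                      [ a ∷ c ∷ (Y - y) ] , ≤-refl , kernel y∈ a∈ c∈ ∷ [] , here
                in 𝒰 , ≤-trans le (≤-reflexive (cong (_* 1) (length-∖ Q∈ lY′))) , ks , cov
          in 𝒰 , ≤-trans le (≤-reflexive (cong (_* 2) (length-∖ P∈ lY))) , ks , cov
          where
          kernel : ∀ {y a c} → y ∈ Y → a ∈ P ∖ Q → c ∈ Q ∖ P → Kernel₁ (a ∷ c ∷ (Y - y))
          kernel {y} {a} {c} y∈ a∈ c∈ =
            let a∈P , a∉Q = ∈-∖⁻ P Q a∈
                c∈Q , c∉P = ∈-∖⁻ Q P c∈
            in unique-∷ (λ { (here refl) → a∉Q c∈Q ; (there p) → a∉Q (proj₂ (∈-⋒⁻ P Q (proj₁ (∈-minus⁻ Y y p)))) })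
                 (unique-∷ (λ p → c∉P (proj₁ (∈-⋒⁻ P Q (proj₁ (∈-minus⁻ Y y p))))) (unique-minus y uY)) ,
               cong suc (trans (≤-antisym (length-minus-< uY y∈) (length-minus-≤ Y y uY)) lY)
        cover : ∀ {𝒰 T} → (∀ {T} → Exchanged T → Covers 𝒰 T) → T ∈ 𝒯 → Dec (Y ⊆ T) → Covers (map (_∷ Y) (V ∖ Y) ++ 𝒰) T
        cover cov T∈ (no ⊈) = Any.++⁺ʳ (map (_∷ Y) (V ∖ Y)) (cov (exchanged T∈ ⊈))
        cover {T = T} cov T∈ (yes Y⊆T) with ⋒-witness {T} {V} {Y} (unique S T∈) (≤-trans
          (≰⇒> λ t≤ → Y⊈V (⋒-full uY (≤-trans (≤-reflexive lY) t≤))) (intersects S T∈ V∈))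
        ... | v , v∈T , v∈V , v∉Y = Any.++⁺ˡ (Any.map⁺ (lose (∈-∖⁺ v∈V v∉Y)
                λ { (here refl) → v∈T ; (there p) → Y⊆T p }))

    common-or-few : (∃ λ X → UniqueList X × length X ≡ t × (∀ {T} → T ∈ 𝒯 → X ⊆ T)) ⊎
                    (∃ λ 𝒲 → All Kernel₁ 𝒲 × (∀ {T} → T ∈ 𝒯 → Covers 𝒲 T) × length 𝒲 ≤ 2 + t + t * 4)
    common-or-few with any? (λ _ → yes tt) 𝒯
    ... | no none = inj₂ ([] , [] , (λ T∈ → contradiction (lose T∈ tt) none) , z≤n)
    ... | yes some with find some
    ... | P , P∈ , _ with any? (λ Q → ¬? (P ⊆? Q)) 𝒯
    -- Every member contains P, so any t elements of P will do.
    ... | no none = inj₁ (take t P , Unique.take⁺ t (unique S P∈) ,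
      trans (length-take t P) (m≤n⇒m⊓n≡m (≤-trans (m≤n+m t 2) (≤-reflexive (sym (size P∈))))) ,
      λ {T} T∈ {z} z∈ → decidable-stable (P ⊆? T) (λ ⊈ → none (lose T∈ ⊈))
        (subst (z ∈_) (take++drop≡id t P) (∈-++⁺ˡ z∈)))
    ... | yes some′ with find some′
    ... | Q , Q∈ , P⊈Q with any? (λ V → ¬? (P ⋒ Q ⊆? V)) 𝒯
    ... | no none = inj₁ (P ⋒ Q , unique-⋒ Q (unique S P∈) ,
      ≤-antisym (⋒-≤ P∈ Q∈ P⊈Q) (intersects S P∈ Q∈) ,
      λ {T} T∈ → decidable-stable (P ⋒ Q ⊆? T) (λ ⊈ → none (lose T∈ ⊈)))
    ... | yes some″ with find some″
    ... | V , V∈ , Y⊈V = inj₂ (few-kernels P∈ Q∈ V∈ P⊈Q Y⊈V)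

-- Partitions of a subset

AllPairs-↭ : ∀ {A : Set} {R : A → A → Set} → (∀ {x y} → R x y → R y x) →
             ∀ {xs ys} → xs ↭ ys → AllPairs R xs → AllPairs R ys
AllPairs-↭ sy _↭_.refl r = r
AllPairs-↭ sy (_↭_.prep x p) (a ∷ r) = All-resp-↭ p a ∷ AllPairs-↭ sy p r
AllPairs-↭ sy (_↭_.swap x y p) ((xy ∷ a) ∷ b ∷ r) =
  (sy xy ∷ All-resp-↭ p b) ∷ All-resp-↭ p a ∷ AllPairs-↭ sy p r
AllPairs-↭ sy (_↭_.trans p q) r = AllPairs-↭ sy q (AllPairs-↭ sy p r)

-- An arbitrary ground subset A is needed for the points left uncovered by prescribed blocks.
PartitionOf : ∀ {n} → Subset n → ℕ → List (Subset n) → Set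
PartitionOf A k bs = length bs ≡ k × All Nonempty bs × AllPairs Disjoint bs × ⋃ bs ≡ A

module _ {n : ℕ} where

  ∈-⋃⁻ : ∀ {x : Fin n} bs → x Sub.∈ ⋃ bs → Any (x Sub.∈_) bs
  ∈-⋃⁻ [] x∈ = contradiction x∈ Sub.∉⊥
  ∈-⋃⁻ (b ∷ bs) x∈ with Sub.x∈p∪q⁻ b (⋃ bs) x∈
  ... | inj₁ p = here p
  ... | inj₂ p = there (∈-⋃⁻ bs p)

  ∈-⋃⁺ : ∀ {x : Fin n} {bs} → Any (x Sub.∈_) bs → x Sub.∈ ⋃ bs
  ∈-⋃⁺ (here p) = Sub.x∈p∪q⁺ (inj₁ p)
  ∈-⋃⁺ (there p) = Sub.x∈p∪q⁺ (inj₂ (∈-⋃⁺ p))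

  Disjoint-sym : ∀ {a b : Subset n} → Disjoint a b → Disjoint b a
  Disjoint-sym {a} {b} d (x , p) = d (x , subst (x Sub.∈_) (Sub.∩-comm b a) p)

  Disjoint⇒∉ : ∀ {a b : Subset n} {x} → Disjoint a b → x Sub.∈ a → x Sub.∉ b
  Disjoint⇒∉ d x∈a x∈b = d (_ , Sub.x∈p∩q⁺ (x∈a , x∈b))

  ∉⇒Disjoint : ∀ {a b : Subset n} → (∀ {x} → x Sub.∈ a → x Sub.∉ b) → Disjoint a b
  ∉⇒Disjoint {a} {b} f (x , p) = let x∈a , x∈b = Sub.x∈p∩q⁻ a b p in f x∈a x∈b

  ⋃-↭ : ∀ {bs cs : List (Subset n)} → bs ↭ cs → ⋃ bs ≡ ⋃ cs
  ⋃-↭ {bs} {cs} p = Sub.⊆-antisym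
    (λ x∈ → ∈-⋃⁺ (Any-resp-↭ p (∈-⋃⁻ bs x∈)))
    (λ x∈ → ∈-⋃⁺ (Any-resp-↭ (↭-sym p) (∈-⋃⁻ cs x∈)))

  PartitionOf-↭ : ∀ {A : Subset n} {k bs cs} → bs ↭ cs → PartitionOf A k bs → PartitionOf A k cs
  PartitionOf-↭ p (l , ne , d , u) =
    trans (sym (↭-length p)) l , All-resp-↭ p ne , AllPairs-↭ (λ {a} {b} → Disjoint-sym {a} {b}) p d , trans (sym (⋃-↭ p)) u

  same-block : ∀ {bs : List (Subset n)} {a b x} → AllPairs Disjoint bs → a ∈ bs → b ∈ bs →
               x Sub.∈ a → x Sub.∈ b → a ≡ b
  same-block d a∈ b∈ x∈a x∈b with ∈-AllPairs₂ d a∈ b∈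
  ... | inj₁ e = e
  ... | inj₂ (inj₁ dis) = contradiction x∈b (Disjoint⇒∉ dis x∈a)
  ... | inj₂ (inj₂ dis) = contradiction x∈a (Disjoint⇒∉ dis x∈b)

  unique-blocks : ∀ {bs : List (Subset n)} → All Nonempty bs → AllPairs Disjoint bs → UniqueList bs
  unique-blocks [] [] = []
  unique-blocks ((x , x∈) ∷ ne) (d ∷ ds) = All.map (λ { dis refl → Disjoint⇒∉ dis x∈ x∈ }) d ∷ unique-blocks ne ds

  infixr 5 _◂_ ▹_
  ▹_ : List (Subset n) → List (Subset (suc n))
  ▹ bs = map (outside Vec.∷_) bs

  _◂_ : Subset n → List (Subset n) → List (Subset (suc n))
  b ◂ bs = (inside Vec.∷ b) ∷ ▹ bs

  map-tail-▹ : ∀ bs → map Vec.tail (▹ bs) ≡ bs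
  map-tail-▹ bs = trans (sym (map-∘ bs)) (map-id bs)

  ▹-↭⁻ : ∀ {bs cs} → ▹ bs ↭ ▹ cs → bs ↭ cs
  ▹-↭⁻ {bs} {cs} p = subst₂ _↭_ (map-tail-▹ bs) (map-tail-▹ cs) (↭.map⁺ Vec.tail p)

  inside∉▹ : ∀ {b : Subset n} bs → (inside Vec.∷ b) ∉ ▹ bs
  inside∉▹ bs p with ∈-map⁻ (outside Vec.∷_) p
  ... | _ , _ , ()

  -- The block containing 0 is recognisable in any order of the blocks.
  ◂-↭⁻ : ∀ {b c bs cs} → b ◂ bs ↭ c ◂ cs → b ≡ c × bs ↭ cs
  ◂-↭⁻ {cs = cs} p with ↭.∈-resp-↭ p (here refl)
  ... | there q = contradiction q (inside∉▹ cs)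
  ... | here refl = refl , ▹-↭⁻ (↭.drop-∷ p)

  ⋃-▹ : ∀ bs → ⋃ (▹ bs) ≡ outside Vec.∷ ⋃ bs
  ⋃-▹ [] = refl
  ⋃-▹ (b ∷ bs) = cong ((outside Vec.∷ b) ∪_) (⋃-▹ bs)

  ▹-nonempty⁺ : ∀ {bs} → All Nonempty bs → All Nonempty (▹ bs)
  ▹-nonempty⁺ ne = All.map⁺ (All.map (λ { (x , x∈) → suc x , Vec.there x∈ }) ne)

  ▹-nonempty⁻ : ∀ {bs} → All Nonempty (▹ bs) → All Nonempty bs
  ▹-nonempty⁻ ne = All.map (λ { (suc x , Vec.there x∈) → x , x∈ }) (All.map⁻ ne)

  ▹-disjoint⁺ : ∀ {bs} → AllPairs Disjoint bs → AllPairs Disjoint (▹ bs)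
  ▹-disjoint⁺ d = AllPairs.map⁺ (AllPairs.map (λ { dis (suc x , Vec.there x∈) → dis (x , x∈) }) d)

  ▹-disjoint⁻ : ∀ {bs} → AllPairs Disjoint (▹ bs) → AllPairs Disjoint bs
  ▹-disjoint⁻ d = AllPairs.map (λ { dis (x , x∈) → dis (suc x , Vec.there x∈) }) (AllPairs.map⁻ d)

  ▹-partition⁺ : ∀ {A k bs} → PartitionOf A k bs → PartitionOf (outside Vec.∷ A) k (▹ bs)
  ▹-partition⁺ {bs = bs} (l , ne , d , u) =
    trans (length-map _ bs) l , ▹-nonempty⁺ ne , ▹-disjoint⁺ d , trans (⋃-▹ bs) (cong (outside Vec.∷_) u)

  ▹-partition⁻ : ∀ {A k bs} → PartitionOf (outside Vec.∷ A) k (▹ bs) → PartitionOf A k bs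
  ▹-partition⁻ {bs = bs} (l , ne , d , u) =
    trans (sym (length-map _ bs)) l , ▹-nonempty⁻ ne , ▹-disjoint⁻ d , cong Vec.tail (trans (sym (⋃-▹ bs)) u)

  ◂-partition⁺ : ∀ {A k b bs} → length bs ≡ k → All Nonempty bs → AllPairs Disjoint (b ∷ bs) → ⋃ (b ∷ bs) ≡ A →
                 PartitionOf (inside Vec.∷ A) (suc k) (b ◂ bs)
  ◂-partition⁺ {b = b} {bs} l ne (d ∷ ds) u =
    cong suc (trans (length-map _ bs) l) ,
    (zero , Vec.here) ∷ ▹-nonempty⁺ ne ,
    All.map⁺ (All.map (λ { dis (suc x , Vec.there x∈) → dis (x , x∈) }) d) ∷ ▹-disjoint⁺ ds ,
    trans (cong ((inside Vec.∷ b) ∪_) (⋃-▹ bs)) (cong (inside Vec.∷_) u)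

  ◂-partition⁻ : ∀ {A k b bs} → PartitionOf (inside Vec.∷ A) (suc k) (b ◂ bs) →
                 length bs ≡ k × All Nonempty bs × AllPairs Disjoint (b ∷ bs) × ⋃ (b ∷ bs) ≡ A
  ◂-partition⁻ {b = b} {bs} (l , _ ∷ ne , d ∷ ds , u) =
    suc-injective (trans (sym (cong suc (length-map _ bs))) l) ,
    ▹-nonempty⁻ ne ,
    All.map (λ { dis (x , x∈) → dis (suc x , Vec.there x∈) }) (All.map⁻ d) ∷ ▹-disjoint⁻ ds ,
    cong Vec.tail (trans (sym (cong ((inside Vec.∷ b) ∪_) (⋃-▹ bs))) u)

  ▹-surjective : ∀ {bs : List (Subset (suc n))} → All (λ b → zero Sub.∉ b) bs → ∃ λ cs → bs ≡ ▹ cs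
  ▹-surjective [] = [] , refl
  ▹-surjective {(true Vec.∷ b) ∷ bs} (z∉ ∷ a) = contradiction Vec.here z∉
  ▹-surjective {(false Vec.∷ b) ∷ bs} (z∉ ∷ a) = let cs , e = ▹-surjective a in b ∷ cs , cong (_ ∷_) e

module _ {A : Set} where

  -- The choices of the block that element 0 joins.
  picks : List A → List (A × List A)
  picks []       = []
  picks (x ∷ xs) = (x , xs) ∷ map (λ (y , ys) → y , x ∷ ys) (picks xs)

  picks-fst : ∀ xs → map proj₁ (picks xs) ≡ xs
  picks-fst [] = refl
  picks-fst (x ∷ xs) = cong (x ∷_) (trans (sym (map-∘ (picks xs))) (picks-fst xs))

  length-picks : ∀ xs → length (picks xs) ≡ length xs
  length-picks xs = trans (sym (length-map proj₁ (picks xs))) (cong length (picks-fst xs))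

  picks-sound : ∀ xs → All (λ (y , ys) → y ∷ ys ↭ xs) (picks xs)
  picks-sound [] = []
  picks-sound (x ∷ xs) = ↭-refl ∷ All.map⁺ (All.map (λ p → ↭-trans (_↭_.swap _ _ ↭-refl) (prep x p)) (picks-sound xs))

  picks-complete : ∀ {y ys xs} → y ∷ ys ↭ xs → Any (λ (z , zs) → y ≡ z × ys ↭ zs) (picks xs)
  picks-complete {y} {ys} {xs} p with find (Any.map⁻ {f = proj₁} (subst (y ∈_) (sym (picks-fst xs)) (↭.∈-resp-↭ p (here refl))))
  ... | (_ , zs) , q , refl = lose q (refl , ↭.drop-∷ (↭-trans p (↭-sym (All.lookup (picks-sound xs) q))))

mark : ∀ {n} → Subset n × List (Subset n) → List (Subset (suc n))
mark (b , bs) = b ◂ bs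

-- Element 0 either forms a block of its own or joins one of the blocks.
partitions : ∀ {n} → Subset n → ℕ → List (List (Subset n))
partitions Vec.[]            zero    = [ [] ]
partitions Vec.[]            (suc k) = []
partitions (outside Vec.∷ A) k       = map ▹_ (partitions A k)
partitions (inside Vec.∷ A)  zero    = []
partitions (inside Vec.∷ A)  (suc k) =
  map (⊥ ◂_) (partitions A k) ++ concatMap (map mark ∘ picks) (partitions A (suc k))

partitions-sound : ∀ {n} (A : Subset n) k → All (PartitionOf A k) (partitions A k)
partitions-sound Vec.[] zero = (refl , [] , [] , refl) ∷ []
partitions-sound Vec.[] (suc k) = []
partitions-sound (outside Vec.∷ A) k = All.map⁺ (All.map ▹-partition⁺ (partitions-sound A k))
partitions-sound (inside Vec.∷ A) zero = []
partitions-sound (inside Vec.∷ A) (suc k) = All.++⁺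
  (All.map⁺ (All.map (λ { (l , ne , d , u) → ◂-partition⁺ l ne
    (All.tabulate (λ _ → ∉⇒Disjoint λ p → contradiction p Sub.∉⊥) ∷ d) (trans (Sub.∪-identityˡ _) u) })
    (partitions-sound A k)))
  (All.concat⁺ (All.map⁺ (All.map (λ {bs} P → All.map⁺ (All.map (marked P) (picks-sound bs))) (partitions-sound A (suc k)))))
  where
  marked : ∀ {bs b cs} → PartitionOf A (suc k) bs → b ∷ cs ↭ bs → PartitionOf (inside Vec.∷ A) (suc k) (b ◂ cs)
  marked P p with PartitionOf-↭ (↭-sym p) P
  ... | l , _ ∷ ne , d , u = ◂-partition⁺ (suc-injective l) ne d u

-- The block of 0 is moved to the front; whether it contains anything besides 0 decides between the
-- two kinds of construction.
partitions-complete : ∀ {n} (A : Subset n) k {bs} → PartitionOf A k bs → Any (bs ↭_) (partitions A k)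
partitions-complete Vec.[] zero {[]} P = here ↭-refl
partitions-complete Vec.[] (suc k) {(b ∷ bs)} (_ , (() , _) ∷ _ , _)
partitions-complete (outside Vec.∷ A) k {bs} P@(_ , _ , _ , u)
  with ▹-surjective {bs = bs} (All.tabulate λ {b} b∈ z∈ → zero∉ (subst (zero Sub.∈_) u (∈-⋃⁺ (lose b∈ z∈))))
  where
  zero∉ : zero Sub.∉ (outside Vec.∷ A)
  zero∉ ()
... | cs , refl = Any.map⁺ (Any.map (↭.map⁺ _) (partitions-complete A k (▹-partition⁻ P)))
partitions-complete {n = suc n} (inside Vec.∷ A) k {bs} P@(_ , _ , _ , u)
  with find (∈-⋃⁻ bs (subst (zero Sub.∈_) (sym u) Vec.here))
... | (.inside Vec.∷ b) , b∈ , Vec.here with ∈-∃++ b∈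
... | us , vs , refl = split k (PartitionOf-↭ (shift _ us vs) P)
  where
  split : ∀ k → PartitionOf (inside Vec.∷ A) k ((inside Vec.∷ b) ∷ us ++ vs) →
          Any ((us ++ (inside Vec.∷ b) ∷ vs) ↭_) (partitions (inside Vec.∷ A) k)
  split (suc k) P′@(_ , _ , d ∷ _ , _) with ▹-surjective {bs = us ++ vs} (All.map (λ dis → Disjoint⇒∉ dis Vec.here) d)
  ... | cs , e with ◂-partition⁻ (subst (λ ds → PartitionOf (inside Vec.∷ A) (suc k) ((inside Vec.∷ b) ∷ ds)) e P′)
  ... | l , ne , d′ , u′ = Any.map (↭-trans (subst (λ ds → us ++ (inside Vec.∷ b) ∷ vs ↭ (inside Vec.∷ b) ∷ ds) e (shift _ us vs)))
                                   (place (Sub.nonempty? b))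
    where
    place : Dec (Nonempty b) → Any (b ◂ cs ↭_) (partitions (inside Vec.∷ A) (suc k))
    place (no empty) with Sub.Empty-unique empty
    ... | refl = Any.++⁺ˡ (Any.map⁺ (Any.map (λ p → prep _ (↭.map⁺ _ p)) (partitions-complete A k
                   (l , ne , AllPairs.tail d′ , trans (sym (Sub.∪-identityˡ _)) u′))))
    place (yes nonempty) = Any.++⁺ʳ (map (⊥ ◂_) (partitions A k)) (Any.concat⁺ (Any.map⁺ (Any.map
      (λ p → Any.map⁺ (Any.map (λ { (refl , q) → prep _ (↭.map⁺ _ q) }) (picks-complete p)))
      (partitions-complete A (suc k) (cong suc l , nonempty ∷ ne , d′ , u′)))))

-- Deleting 0 recovers the partition it was added to, and the block of 0 recovers the pick. The two
-- kinds differ in whether 0 is alone.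
partitions-distinct : ∀ {n} (A : Subset n) k → AllPairs (λ bs cs → ¬ (bs ↭ cs)) (partitions A k)
partitions-distinct Vec.[] zero = [] ∷ []
partitions-distinct Vec.[] (suc k) = []
partitions-distinct (outside Vec.∷ A) k = AllPairs.map⁺ (AllPairs.map (λ ≉ p → ≉ (▹-↭⁻ p)) (partitions-distinct A k))
partitions-distinct (inside Vec.∷ A) zero = []
partitions-distinct {suc n} (inside Vec.∷ A) (suc k) = AllPairs.++⁺
  (AllPairs.map⁺ (AllPairs.map (λ ≉ p → ≉ (proj₂ (◂-↭⁻ p))) (partitions-distinct A k)))
  (AllPairs.concat⁺
    (All.map⁺ (All.map within (partitions-sound A (suc k))))
    (AllPairs.map⁺ (AllPairs.map across (partitions-distinct A (suc k)))))
  (All.map⁺ (All.tabulate λ _ → All.concat⁺ (All.map⁺ (All.map apart (partitions-sound A (suc k))))))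
  where
  within : ∀ {bs} → PartitionOf A (suc k) bs → AllPairs (λ bs cs → ¬ (bs ↭ cs)) (map mark (picks bs))
  within {bs} (_ , ne , d , _) = AllPairs.map⁺ (AllPairs.map (λ ≢ p → ≢ (proj₁ (◂-↭⁻ p)))
    (AllPairs.map⁻ (subst UniqueList (sym (picks-fst bs)) (unique-blocks ne d))))
  across : ∀ {bs cs} → ¬ (bs ↭ cs) → All (λ x → All (λ y → ¬ (x ↭ y)) (map mark (picks cs))) (map mark (picks bs))
  across {bs} {cs} ≉ = All.map⁺ (All.map (λ p → All.map⁺ (All.map (λ q r → ≉ (merge p q (◂-↭⁻ r))) (picks-sound cs))) (picks-sound bs))
    where
    merge : ∀ {b c bs′ cs′} → b ∷ bs′ ↭ bs → c ∷ cs′ ↭ cs → b ≡ c × bs′ ↭ cs′ → bs ↭ cs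
    merge p q (refl , r) = ↭-trans (↭-sym p) (↭-trans (prep _ r) q)
  apart : ∀ {cs bs} → PartitionOf A (suc k) bs → All (λ y → ¬ (⊥ ◂ cs ↭ y)) (map mark (picks bs))
  apart {bs = bs} (_ , ne , _) = All.map⁺ (All.map (λ p q → nonempty-pick (All-resp-↭ (↭-sym p) ne) (◂-↭⁻ q)) (picks-sound bs))
    where
    nonempty-pick : ∀ {b : Subset n} {bs′ cs′} → All Nonempty (b ∷ bs′) → ¬ (⊥ ≡ b × cs′ ↭ bs′)
    nonempty-pick ((x , x∈) ∷ _) (refl , _) = Sub.∉⊥ x∈

length-partitions : ∀ {n} (A : Subset n) k → length (partitions A k) ≡ stirling ∣ A ∣ k
length-partitions Vec.[] zero = refl
length-partitions Vec.[] (suc k) = refl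
length-partitions (outside Vec.∷ A) k = trans (length-map ▹_ (partitions A k)) (length-partitions A k)
length-partitions (inside Vec.∷ A) zero = refl
length-partitions (inside Vec.∷ A) (suc k) = trans (length-++ (map (⊥ ◂_) (partitions A k))) (cong₂ _+_
  (trans (length-map (⊥ ◂_) (partitions A k)) (length-partitions A k))
  (trans (length-concatMap (map mark ∘ picks) (All.map (λ { {bs} (l , _) → trans (length-map mark (picks bs)) (trans (length-picks bs) l) }) (partitions-sound A (suc k))))
         (cong (suc k *_) (length-partitions A (suc k)))))

-- Partitions with prescribed blocks

unique-set⇒↭ : {A : Set} {xs ys : List A} → UniqueList xs → UniqueList ys → xs ⊆ ys → ys ⊆ xs → xs ↭ ys
unique-set⇒↭ u v f g = ∼bag⇒↭ (unique∧set⇒bag u v (mk⇔ f g))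

module _ {A : Set} where

  sublists-⊆ : ∀ (xs : List A) {ys} → ys ∈ sublists xs → ys ⊆ xs
  sublists-⊆ [] (here refl) = id
  sublists-⊆ (x ∷ xs) p with ∈-++⁻ (map (x ∷_) (sublists xs)) p
  ... | inj₂ q = there ∘ sublists-⊆ xs q
  ... | inj₁ q with ∈-map⁻ (x ∷_) q
  ... | zs , zs∈ , refl = λ { (here e) → here e ; (there z∈) → there (sublists-⊆ xs zs∈ z∈) }

  sublists-distinct : ∀ {xs : List A} → UniqueList xs → AllPairs (λ ys zs → ¬ (ys ↭ zs)) (sublists xs)
  sublists-distinct [] = [] ∷ []
  sublists-distinct {x ∷ xs} (x≢ ∷ u) = AllPairs.++⁺
    (AllPairs.map⁺ (AllPairs.map (λ ≉ p → ≉ (↭.drop-∷ p)) (sublists-distinct u)))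
    (sublists-distinct u)
    (All.map⁺ (All.tabulate λ _ → All.tabulate λ zs∈ p →
      All.lookup x≢ (sublists-⊆ xs zs∈ (↭.∈-resp-↭ p (here refl))) refl))

  filter∈sublists : ∀ {P : A → Set} (P? : ∀ x → Dec (P x)) xs → filter P? xs ∈ sublists xs
  filter∈sublists P? [] = here refl
  filter∈sublists P? (x ∷ xs) with P? x
  ... | yes _ = ∈-++⁺ˡ (∈-map⁺ (x ∷_) (filter∈sublists P? xs))
  ... | no _ = ∈-++⁺ʳ (map (x ∷_) (sublists xs)) (filter∈sublists P? xs)

∈-allSubsets : ∀ {n} (b : Subset n) → b ∈ allSubsets n
∈-allSubsets Vec.[] = here refl
∈-allSubsets (true Vec.∷ b) = ∈-++⁺ˡ (∈-map⁺ _ (∈-allSubsets b))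
∈-allSubsets {suc n} (false Vec.∷ b) = ∈-++⁺ʳ (map (inside Vec.∷_) (allSubsets n)) (∈-map⁺ _ (∈-allSubsets b))

unique-allSubsets : ∀ n → UniqueList (allSubsets n)
unique-allSubsets zero = [] ∷ []
unique-allSubsets (suc n) = Unique.++⁺
  (Unique.map⁺ Vec.∷-injectiveʳ (unique-allSubsets n))
  (Unique.map⁺ Vec.∷-injectiveʳ (unique-allSubsets n))
  λ (p , q) → let _ , _ , e₁ = ∈-map⁻ _ p ; _ , _ , e₂ = ∈-map⁻ _ q in heads (trans (sym e₁) e₂)
  where
  heads : ∀ {a b : Subset n} → ¬ (inside Vec.∷ a ≡ outside Vec.∷ b)
  heads ()

-- Both lists contain each partition exactly once up to order, so pigeonhole applies both ways. The
-- representative counted by `S` lists the blocks in the order of `allSubsets m`.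
S≡stirling : ∀ m j → S m j ≡ stirling m j
S≡stirling m j = begin
  S m j                        ≡⟨ ≤-antisym
    (pigeonhole {R = _↭_} joinable (AllPairs.filter⁺ (isPartition? m j) (sublists-distinct (unique-allSubsets m)))
      (All.tabulate λ bs∈ → partitions-complete ⊤ j (proj₂ (∈-filter⁻ (isPartition? m j) {xs = sublists (allSubsets m)} bs∈))))
    (pigeonhole {R = _↭_} joinable (partitions-distinct ⊤ j) (All.map canonical (partitions-sound ⊤ j))) ⟩
  length (partitions (⊤ {m}) j) ≡⟨ length-partitions (⊤ {m}) j ⟩
  stirling ∣ ⊤ {m} ∣ j         ≡⟨ cong (λ x → stirling x j) (Sub.∣⊤∣≡n m) ⟩
  stirling m j                 ∎
  where
  open ≡-Reasoning
  joinable : ∀ {bs cs ds : List (Subset m)} → bs ↭ ds → cs ↭ ds → ¬ ¬ (bs ↭ cs)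
  joinable p q ≉ = ≉ (↭-trans p (↭-sym q))
  canonical : ∀ {bs} → PartitionOf ⊤ j bs → Any (bs ↭_) (filter (isPartition? m j) (sublists (allSubsets m)))
  canonical {bs} P@(_ , ne , d , _) = lose (∈-filter⁺ (isPartition? m j) (filter∈sublists (_∈? bs) (allSubsets m)) (PartitionOf-↭ p P)) p
    where
    open DecMembership (_≟ˢ_ {m}) using (_∈?_)
    p : bs ↭ filter (_∈? bs) (allSubsets m)
    p = unique-set⇒↭ (unique-blocks ne d) (Unique.filter⁺ (_∈? bs) (unique-allSubsets m))
      (λ b∈ → ∈-filter⁺ (_∈? bs) (∈-allSubsets _) b∈) (λ b∈ → proj₂ (∈-filter⁻ (_∈? bs) {xs = allSubsets m} b∈))

module _ {n : ℕ} where
  open SetFamilies (_≟ˢ_ {n})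
  open DecMembership (_≟ˢ_ {n}) using (_∈?_)

  ∣∪∣-disjoint : ∀ {m} (a b : Subset m) → Disjoint a b → ∣ a ∪ b ∣ ≡ ∣ a ∣ + ∣ b ∣
  ∣∪∣-disjoint Vec.[] Vec.[] d = refl
  ∣∪∣-disjoint (true Vec.∷ a) (true Vec.∷ b) d = contradiction (zero , Vec.here) d
  ∣∪∣-disjoint (true Vec.∷ a) (false Vec.∷ b) d = cong suc (∣∪∣-disjoint a b λ (x , p) → d (suc x , Vec.there p))
  ∣∪∣-disjoint (false Vec.∷ a) (true Vec.∷ b) d = trans (cong suc (∣∪∣-disjoint a b λ (x , p) → d (suc x , Vec.there p))) (sym (+-suc ∣ a ∣ ∣ b ∣))
  ∣∪∣-disjoint (false Vec.∷ a) (false Vec.∷ b) d = ∣∪∣-disjoint a b λ (x , p) → d (suc x , Vec.there p)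

  ∣⋃∣-disjoint : ∀ {W : List (Subset n)} → AllPairs Disjoint W → ∣ ⋃ W ∣ ≡ sum (map ∣_∣ W)
  ∣⋃∣-disjoint [] = Sub.∣⊥∣≡0 n
  ∣⋃∣-disjoint {b ∷ W} (d ∷ ds) = trans (∣∪∣-disjoint b (⋃ W) (∉⇒Disjoint λ x∈b x∈W →
    let c , c∈ , x∈c = find (∈-⋃⁻ W x∈W) in Disjoint⇒∉ (All.lookup d c∈) x∈b x∈c)) (cong (∣ b ∣ +_) (∣⋃∣-disjoint ds))

  ∣nonempty∣ : ∀ {b : Subset n} → Nonempty b → 1 ≤ ∣ b ∣
  ∣nonempty∣ (x , x∈) = ≤-trans (≤-reflexive (sym (Sub.∣⁅x⁆∣≡1 x)))
    (Sub.p⊆q⇒∣p∣≤∣q∣ λ y∈ → subst (Sub._∈ _) (sym (Sub.x∈⁅y⁆⇒x≡y x y∈)) x∈)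

  length≤sizes : ∀ {W : List (Subset n)} → All Nonempty W → length W ≤ sum (map ∣_∣ W)
  length≤sizes [] = z≤n
  length≤sizes (ne ∷ nes) = +-mono-≤ (∣nonempty∣ ne) (length≤sizes nes)

  sizes≡length⇒1 : ∀ {W : List (Subset n)} → All Nonempty W → sum (map ∣_∣ W) ≤ length W → All (λ b → ∣ b ∣ ≤ 1) W
  sizes≡length⇒1 [] le = []
  sizes≡length⇒1 {b ∷ W} (ne ∷ nes) le =
    +-cancelʳ-≤ (length W) ∣ b ∣ 1 (≤-trans (+-monoʳ-≤ ∣ b ∣ (length≤sizes nes)) le) ∷
    sizes≡length⇒1 nes (s≤s⁻¹ (≤-trans (+-monoˡ-≤ _ (∣nonempty∣ ne)) le))

  ∣∣≤1⇒singleton : ∀ {b : Subset n} {x} → ∣ b ∣ ≤ 1 → x Sub.∈ b → b ≡ ⁅ x ⁆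
  ∣∣≤1⇒singleton {b} {x} le x∈ = Sub.⊆-antisym sub (λ y∈ → subst (Sub._∈ b) (sym (Sub.x∈⁅y⁆⇒x≡y x y∈)) x∈)
    where
    sub : ∀ {y} → y Sub.∈ b → y Sub.∈ ⁅ x ⁆
    sub {y} y∈ with y ≟ᶠ x
    ... | yes refl = Sub.x∈⁅x⁆ x
    ... | no y≢x = contradiction (≤-trans (≤-trans two (Sub.p⊆q⇒∣p∣≤∣q∣ both)) le) λ { (s≤s ()) }
      where
      two : 2 ≤ ∣ ⁅ x ⁆ ∪ ⁅ y ⁆ ∣
      two = ≤-reflexive (sym (trans (∣∪∣-disjoint ⁅ x ⁆ ⁅ y ⁆ (∉⇒Disjoint λ p q →
        y≢x (trans (sym (Sub.x∈⁅y⁆⇒x≡y y q)) (Sub.x∈⁅y⁆⇒x≡y x p)))) (cong₂ _+_ (Sub.∣⁅x⁆∣≡1 x) (Sub.∣⁅x⁆∣≡1 y))))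
      both : ∀ {z} → z Sub.∈ ⁅ x ⁆ ∪ ⁅ y ⁆ → z Sub.∈ b
      both p with Sub.x∈p∪q⁻ ⁅ x ⁆ ⁅ y ⁆ p
      ... | inj₁ q = subst (Sub._∈ b) (sym (Sub.x∈⁅y⁆⇒x≡y x q)) x∈
      ... | inj₂ q = subst (Sub._∈ b) (sym (Sub.x∈⁅y⁆⇒x≡y y q)) y∈

  disjoint-⊆ : ∀ {W bs : List (Subset n)} → UniqueList W → W ⊆ bs → AllPairs Disjoint bs → AllPairs Disjoint W
  disjoint-⊆ [] sub d = []
  disjoint-⊆ (w≢ ∷ u) sub d = All.tabulate (λ v∈ → apart (All.lookup w≢ v∈) (∈-AllPairs₂ d (sub (here refl)) (sub (there v∈)))) ∷ disjoint-⊆ u (sub ∘ there) d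
    where
    apart : ∀ {a b : Subset n} → a ≢ b → a ≡ b ⊎ Disjoint a b ⊎ Disjoint b a → Disjoint a b
    apart ≢ (inj₁ e) = contradiction e ≢
    apart ≢ (inj₂ (inj₁ dis)) = dis
    apart {a} {b} ≢ (inj₂ (inj₂ dis)) = Disjoint-sym {a = b} {a} dis

  -- A point of ⋃ W lies in no block outside W, so the other blocks partition exactly the
  -- complement.
  residual : ∀ {k bs} {W : List (Subset n)} → IsPartition n k bs → UniqueList W → W ⊆ bs →
             Any (λ cs → bs ↭ W ++ cs) (partitions (∁ (⋃ W)) (k ∸ length W))
  residual {k} {bs} {W} (l , ne , d , u) uW W⊆ =
    Any.map (λ p → ↭-trans split (↭.++⁺ˡ W p)) (partitions-complete (∁ (⋃ W)) (k ∸ length W) rest-partition)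
    where
    rest = bs ∖ W
    uB = unique-blocks ne d
    split : bs ↭ W ++ rest
    split = unique-set⇒↭ uB (Unique.++⁺ uW (unique-∖ W uB) (λ (p , q) → proj₂ (∈-∖⁻ bs W q) p))
      (λ {b} b∈ → sort b∈ (b ∈? W)) λ b∈ → back (∈-++⁻ W b∈)
      where
      sort : ∀ {b} → b ∈ bs → Dec (b ∈ W) → b ∈ W ++ rest
      sort b∈ (yes p) = ∈-++⁺ˡ p
      sort b∈ (no p) = ∈-++⁺ʳ W (∈-∖⁺ b∈ p)
      back : ∀ {b} → b ∈ W ⊎ b ∈ rest → b ∈ bs
      back (inj₁ p) = W⊆ p
      back (inj₂ p) = proj₁ (∈-∖⁻ bs W p)
    rest-partition : PartitionOf (∁ (⋃ W)) (k ∸ length W) rest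
    rest-partition =
      sym (trans (cong (_∸ length W) (trans (sym l) (trans (↭-length split) (length-++ W)))) (m+n∸m≡n (length W) (length rest))) ,
      All.filter⁺ _ ne , AllPairs.filter⁺ _ d ,
      Sub.⊆-antisym
        (λ x∈ → let b , b∈ , x∈b = find (∈-⋃⁻ rest x∈)
                    b∈bs , b∉W = ∈-∖⁻ bs W b∈
                in Sub.x∉p⇒x∈∁p λ x∈W → let w , w∈ , x∈w = find (∈-⋃⁻ W x∈W) in
                   b∉W (subst (_∈ W) (same-block d (W⊆ w∈) b∈bs x∈w x∈b) w∈))
        (λ {x} x∈ → let b , b∈ , x∈b = find (∈-⋃⁻ bs (subst (x Sub.∈_) (sym u) Sub.∈⊤)) in
           ∈-⋃⁺ (lose (∈-∖⁺ b∈ λ b∈W → Sub.x∈∁p⇒x∉p x∈ (∈-⋃⁺ (lose b∈W x∈b))) x∈b))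

  join : ∀ {t k cs} {W : List (Subset n)} → t ≤ k → PartitionOf (⋃ W) t W → PartitionOf (∁ (⋃ W)) (k ∸ t) cs →
         IsPartition n k (W ++ cs)
  join {t} {k} {cs} {W} t≤k (l , ne , d , _) (l′ , ne′ , d′ , u′) =
    trans (length-++ W) (trans (cong₂ _+_ l l′) (m+[n∸m]≡n t≤k)) ,
    All.++⁺ ne ne′ ,
    AllPairs.++⁺ d d′ (All.tabulate λ w∈ → All.tabulate λ c∈ → ∉⇒Disjoint λ {x} x∈w x∈c →
      Sub.x∈∁p⇒x∉p (subst (x Sub.∈_) u′ (∈-⋃⁺ (lose c∈ x∈c))) (∈-⋃⁺ (lose w∈ x∈w))) ,
    Sub.⊆-antisym (λ _ → Sub.∈⊤) (λ {x} _ → place x (x Sub.∈? ⋃ W))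
    where
    place : ∀ x → Dec (x Sub.∈ ⋃ W) → x Sub.∈ ⋃ (W ++ cs)
    place x (yes p) = ∈-⋃⁺ (Any.++⁺ˡ (∈-⋃⁻ W p))
    place x (no p) = ∈-⋃⁺ (Any.++⁺ʳ W (∈-⋃⁻ cs (subst (x Sub.∈_) (sym u′) (Sub.x∉p⇒x∈∁p p))))

  singletons : Subset n → List (Subset n)
  singletons T = map ⁅_⁆ (filter (Sub._∈? T) (allFin n))

  ∈-singletons⁺ : ∀ {T x} → x Sub.∈ T → ⁅ x ⁆ ∈ singletons T
  ∈-singletons⁺ {T} {x} x∈ = ∈-map⁺ ⁅_⁆ (∈-filter⁺ (Sub._∈? T) (∈-allFin x) x∈)

  ∈-singletons⁻ : ∀ {T b} → b ∈ singletons T → ∃ λ x → x Sub.∈ T × b ≡ ⁅ x ⁆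
  ∈-singletons⁻ {T} b∈ = let x , x∈ , e = ∈-map⁻ ⁅_⁆ b∈ in x , proj₂ (∈-filter⁻ (Sub._∈? T) {xs = allFin n} x∈) , e

  ⋃-singletons : ∀ T → ⋃ (singletons T) ≡ T
  ⋃-singletons T = Sub.⊆-antisym
    (λ {y} y∈ → let b , b∈ , y∈b = find (∈-⋃⁻ (singletons T) y∈)
                    x , x∈ , e = ∈-singletons⁻ b∈
                in subst (Sub._∈ T) (sym (Sub.x∈⁅y⁆⇒x≡y x (subst (y Sub.∈_) e y∈b))) x∈)
    (λ {x} x∈ → ∈-⋃⁺ (lose (∈-singletons⁺ x∈) (Sub.x∈⁅x⁆ x)))

  singletons-partition : ∀ T → PartitionOf (⋃ (singletons T)) ∣ T ∣ (singletons T)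
  singletons-partition T = sym count , ne , dis , refl
    where
    ne : All Nonempty (singletons T)
    ne = All.map⁺ (All.tabulate λ {x} _ → x , Sub.x∈⁅x⁆ x)
    dis : AllPairs Disjoint (singletons T)
    dis = AllPairs.map⁺ (AllPairs.map (λ {x} {y} x≢y → ∉⇒Disjoint λ p q →
        x≢y (trans (sym (Sub.x∈⁅y⁆⇒x≡y x p)) (Sub.x∈⁅y⁆⇒x≡y y q)))
      (Unique.filter⁺ (Sub._∈? T) (Unique.allFin⁺ n)))
    sizes : ∀ xs → sum (map ∣_∣ (map (⁅_⁆ {n}) xs)) ≡ length (map (⁅_⁆ {n}) xs)
    sizes [] = refl
    sizes (x ∷ xs) = cong₂ _+_ (Sub.∣⁅x⁆∣≡1 x) (sizes xs)
    count : ∣ T ∣ ≡ length (singletons T)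
    count = trans (cong ∣_∣ (sym (⋃-singletons T))) (trans (∣⋃∣-disjoint dis) (sizes (filter (Sub._∈? T) (allFin n))))

-- Intersecting families of partitions

-- Stirling numbers made monotone in m: `stirling 0 0` is 1, but `stirling (suc m) 0` is 0. This
-- matters when W is a whole partition, where no point is left although n may exceed |W|.
cap : ℕ → ℕ → ℕ
cap m zero    = 1
cap m (suc i) = stirling m (suc i)

stirling≤cap : ∀ {l m} i → l ≤ m → stirling l i ≤ cap m i
stirling≤cap {zero}  zero    le = ≤-refl
stirling≤cap {suc l} zero    le = z≤n
stirling≤cap         (suc i) le = stirling-mono i le

stirling≤1 : ∀ m {i} → i ≤ 1 → stirling m i ≤ 1
stirling≤1 zero    {zero} _ = ≤-refl
stirling≤1 (suc m) {zero} _ = z≤n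
stirling≤1 zero    {suc zero} _ = z≤n
stirling≤1 (suc m) {suc zero} _ = ≤-reflexive (stirling-1 m)
stirling≤1 m {suc (suc i)} (s≤s ())

sum-mono : {A : Set} {f h : A → ℕ} {xs : List A} → All (λ x → f x ≤ h x) xs → sum (map f xs) ≤ sum (map h xs)
sum-mono [] = z≤n
sum-mono (le ∷ a) = +-mono-≤ le (sum-mono a)

sum-const : {A : Set} {f : A → ℕ} {c : ℕ} {xs : List A} → All (λ x → f x ≤ c) xs → sum (map f xs) ≤ length xs * c
sum-const [] = z≤n
sum-const (le ∷ a) = +-mono-≤ le (sum-const a)

++-cancelˡ-↭ : {A : Set} (ws : List A) {xs ys : List A} → ws ++ xs ↭ ws ++ ys → xs ↭ ys
++-cancelˡ-↭ []       p = p
++-cancelˡ-↭ (w ∷ ws) p = ++-cancelˡ-↭ ws (↭.drop-∷ p)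

module _ {n k : ℕ} where
  open SetFamilies (_≟ˢ_ {n})
  open DecMembership (_≟ˢ_ {n}) using (_∈?_)

  joinable : ∀ {W : List (Subset n)} {P Q : KPartition n k} {cs} →
             blocks P ↭ W ++ cs → blocks Q ↭ W ++ cs → ¬ ¬ (blocks P ↭ blocks Q)
  joinable p q ≉ = ≉ (↭-trans p (↭-sym q))

  unique-KPartition : (P : KPartition n k) → UniqueList (blocks P)
  unique-KPartition (_ , _ , ne , d , _) = unique-blocks ne d

  hits : ∀ {W} {L : List (KPartition n k)} → UniqueList W → All (λ P → W ⊆ blocks P) L →
         All (λ P → Any (λ cs → blocks P ↭ W ++ cs) (partitions (∁ (⋃ W)) (k ∸ length W))) L
  hits uW = All.map λ {P} sub → residual (proj₂ P) uW (λ {x} → sub {x})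

  count-⊇ : ∀ {W} {L : List (KPartition n k)} → Unique L → UniqueList W → All (λ P → W ⊆ blocks P) L →
            length L ≤ stirling ∣ ∁ (⋃ W) ∣ (k ∸ length W)
  count-⊇ {W} u uW a = ≤-trans (pigeonhole {R = λ P cs → blocks P ↭ W ++ cs} (λ {P} {Q} → joinable {W} {P} {Q}) u (hits uW a))
    (≤-reflexive (length-partitions (∁ (⋃ W)) (k ∸ length W)))

  ∣∁⋃∣ : ∀ {W} (P : KPartition n k) → UniqueList W → W ⊆ blocks P → ∣ ∁ (⋃ W) ∣ ≡ n ∸ sum (map ∣_∣ W)
  ∣∁⋃∣ {W} (_ , _ , _ , d , _) uW sub = trans (Sub.∣∁p∣≡n∸∣p∣ (⋃ W)) (cong (n ∸_) (∣⋃∣-disjoint (disjoint-⊆ uW sub d)))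

  nonempty-⊆ : ∀ {W} (P : KPartition n k) → W ⊆ blocks P → All Nonempty W
  nonempty-⊆ (_ , _ , ne , _) sub = All.tabulate λ w∈ → All.lookup ne (sub w∈)

  capW : List (Subset n) → ℕ
  capW W = cap (n ∸ length W) (k ∸ length W)

  -- Blocks are nonempty, so W covers at least |W| points.
  count-⊇-cap : ∀ {W} {L : List (KPartition n k)} → Unique L → UniqueList W → All (λ P → W ⊆ blocks P) L → length L ≤ capW W
  count-⊇-cap [] uW [] = z≤n
  count-⊇-cap {W} {P ∷ L} u uW a@(sub ∷ _) = ≤-trans (count-⊇ u uW a) (stirling≤cap (k ∸ length W) (begin
    ∣ ∁ (⋃ W) ∣           ≡⟨ ∣∁⋃∣ P uW sub ⟩
    n ∸ sum (map ∣_∣ W)   ≤⟨ ∸-monoʳ-≤ n (length≤sizes (nonempty-⊆ P sub)) ⟩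
    n ∸ length W          ∎))
    where open ≤-Reasoning

  -- Each partition is charged to the first W that it contains.
  count-covered : ∀ 𝒲 {L : List (KPartition n k)} → Unique L → All UniqueList 𝒲 → All (λ P → Covers 𝒲 (blocks P)) L →
                  length L ≤ sum (map capW 𝒲)
  count-covered [] {[]} u [] a = z≤n
  count-covered [] {P ∷ L} u [] (() ∷ _)
  count-covered (W ∷ 𝒲) {L} u (uW ∷ u𝒲) a = begin
    length L                                                ≡⟨ length-filter-¬ has? L ⟨
    length (filter has? L) + length (filter (¬? ∘ has?) L)  ≤⟨ +-mono-≤
      (count-⊇-cap (AllPairs.filter⁺ has? u) uW (All.all-filter has? L))
      (count-covered 𝒲 (AllPairs.filter⁺ (¬? ∘ has?) u) u𝒲 (All.tabulate λ {P} P∈ →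
        let P∈L , W⊈ = ∈-filter⁻ (¬? ∘ has?) {xs = L} P∈ in other {P} W⊈ (All.lookup a P∈L))) ⟩
    capW W + sum (map capW 𝒲)                               ∎
    where
    open ≤-Reasoning
    has? : ∀ P → Dec (W ⊆ blocks P)
    has? P = W ⊆? blocks P
    other : ∀ {P} → ¬ (W ⊆ blocks P) → Covers (W ∷ 𝒲) (blocks P) → Covers 𝒲 (blocks P)
    other W⊈ (here sub) = contradiction (λ {x} → sub {x}) W⊈
    other W⊈ (there c) = c

  -- Otherwise P and Q would be two partitions with all but one block prescribed.
  near-partitions : ∀ (P Q : KPartition n k) → k ≤ suc (length (blocks P ⋒ blocks Q)) → blocks P ⊆ blocks Q
  near-partitions P Q le = decidable-stable (blocks P ⊆? blocks Q) λ P⊈Q → contradiction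
    (≤-trans (count-⊇ {W} {P ∷ Q ∷ []} (((λ p → P⊈Q (↭.∈-resp-↭ p)) ∷ []) ∷ [] ∷ [])
        (unique-⋒ (blocks Q) (unique-KPartition P))
        ((λ z∈ → proj₁ (∈-⋒⁻ (blocks P) (blocks Q) z∈)) ∷ (λ z∈ → proj₂ (∈-⋒⁻ (blocks P) (blocks Q) z∈)) ∷ []))
      (stirling≤1 ∣ ∁ (⋃ W) ∣ (≤-trans (∸-monoˡ-≤ (length W) le) (≤-reflexive (m+n∸n≡m 1 (length W)))))) λ { (s≤s ()) }
    where W = blocks P ⋒ blocks Q

  -- A point of c lies in some block b of P. If b is a block of Q, then b = c; if not, b and c both
  -- belong to T, and again b = c. But c is not a block of P.
  exchange-partitions : ∀ (P Q T : KPartition n k) → blocks P ∖ blocks Q ⊆ blocks T →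
                        ∀ {c} → c ∈ blocks Q ∖ blocks P → c ∉ blocks T
  exchange-partitions (bs , _ , _ , _ , u) (cs , _ , ne , d , _) (ds , _ , _ , d′ , _) sub {c} c∈ c∈T
    with ∈-∖⁻ cs bs c∈
  ... | c∈cs , c∉bs with All.lookup ne c∈cs
  ... | x , x∈c with find (∈-⋃⁻ bs (subst (x Sub.∈_) (sym u) Sub.∈⊤))
  ... | b , b∈ , x∈b with b ∈? cs
  ... | yes b∈cs = c∉bs (subst (_∈ bs) (same-block d b∈cs c∈cs x∈b x∈c) b∈)
  ... | no b∉cs = c∉bs (subst (_∈ bs) (same-block d′ (sub (∈-∖⁺ b∈ b∉cs)) c∈T x∈b x∈c) b∈)

  -- The bound M and the families attaining it

  module _ {t p m : ℕ} (n≡ : n ≡ t + 1 + m) (k≡ : k ≡ t + (2 + p)) (large : suc (5 * k) ^ suc p ≤ 2 ^ m)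
           (F : Family n k) (int : Intersecting t F) where

    private
      M = stirling (suc m) (2 + p)
      𝒯 = map blocks (members F)

      1≤5k : 1 ≤ 5 * k
      1≤5k = ≤-trans (≤-trans (s≤s z≤n) (≤-trans (m≤n+m (2 + p) t) (≤-reflexive (sym k≡)))) (m≤n*m k 5)

      ∈𝒯 : ∀ {T} → T ∈ 𝒯 → ∃ λ P → P ∈ members F × T ≡ blocks P
      ∈𝒯 = ∈-map⁻ blocks

      ∈⇒∈ᶠ : ∀ {P} → P ∈ members F → P ∈ᶠ members F
      ∈⇒∈ᶠ = Any.map λ { refl → ↭-refl }

      size : ∀ {T} → T ∈ 𝒯 → length T ≡ k
      size T∈ with ∈𝒯 T∈
      ... | P , _ , refl = proj₁ (proj₂ P)

      sets : ∀ {q} → k ≤ q → Sets t q 𝒯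
      sets k≤q = record
        { unique = uniq
        ; bounded = λ T∈ → ≤-trans (≤-reflexive (size T∈)) k≤q
        ; intersects = inter
        }
        where
        uniq : ∀ {T} → T ∈ 𝒯 → UniqueList T
        uniq T∈ with ∈𝒯 T∈
        ... | P , _ , refl = unique-KPartition P
        inter : Intersects t 𝒯
        inter T∈ U∈ with ∈𝒯 T∈ | ∈𝒯 U∈
        ... | P , P∈ , refl | Q , Q∈ , refl = int P Q (∈⇒∈ᶠ P∈) (∈⇒∈ᶠ Q∈)

      covers-members : ∀ {𝒲} → (∀ {T} → T ∈ 𝒯 → Covers 𝒲 T) → All (λ P → Covers 𝒲 (blocks P)) (members F)
      covers-members cov = All.tabulate λ P∈ → cov (∈-map⁺ blocks P∈)

      n∸[t+s] : ∀ s m′ → m ≡ s + m′ → n ∸ (t + s) ≡ suc m′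
      n∸[t+s] s m′ refl = trans (cong (_∸ (t + s)) (trans n≡ (regroup t s m′))) (m+n∸m≡n (t + s) (suc m′))
        where
        regroup : ∀ t s m → t + 1 + (s + m) ≡ t + s + suc m
        regroup = solve-∀

      k∸[t+s] : ∀ s i → 2 + p ≡ s + i → k ∸ (t + s) ≡ i
      k∸[t+s] s i e = trans (cong (_∸ (t + s)) (trans k≡ (trans (cong (t +_) e) (sym (+-assoc t s i))))) (m+n∸m≡n (t + s) i)

    M-positive : 1 ≤ M
    M-positive = stirling-positive {5 * k} (suc p) m 1≤5k large

    CommonBlocks : Set
    CommonBlocks = ∃ λ X → UniqueList X × length X ≡ t × All (λ P → X ⊆ blocks P) (members F)

    private
      common : (∃ λ X → UniqueList X × length X ≡ t × (∀ {T} → T ∈ 𝒯 → X ⊆ T)) → CommonBlocks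
      common (X , uX , lX , sub) = X , uX , lX , All.tabulate λ P∈ {x} → sub (∈-map⁺ blocks P∈) {x}

      -- A kernel of t + 1 blocks leaves one block to choose, so it lies in at most one partition.
      -- The at most 5t + 2 kernels fall short by 8 of 5(t + 2) = 5k ≤ M.
      codimension-two : p ≡ 0 → CommonBlocks ⊎ card F < M
      codimension-two refl = conclude (CodimensionTwo.common-or-few (sets (≤-reflexive k≡2+t)) (λ T∈ → trans (size T∈) k≡2+t) near exchange)
        where
        k≡2+t = trans k≡ (+-comm t 2)
        near : ∀ {P Q} → P ∈ 𝒯 → Q ∈ 𝒯 → t < length (P ⋒ Q) → P ⊆ Q
        near P∈ Q∈ lt with ∈𝒯 P∈ | ∈𝒯 Q∈
        ... | P , _ , refl | Q , _ , refl = near-partitions P Q (≤-trans (≤-reflexive k≡2+t) (s≤s lt))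
        exchange : ∀ {P Q T} → P ∈ 𝒯 → Q ∈ 𝒯 → T ∈ 𝒯 → P ∖ Q ⊆ T → ∀ {c} → c ∈ Q ∖ P → c ∉ T
        exchange P∈ Q∈ T∈ with ∈𝒯 P∈ | ∈𝒯 Q∈ | ∈𝒯 T∈
        ... | P , _ , refl | Q , _ , refl | T , _ , refl = exchange-partitions P Q T
        conclude : _ → CommonBlocks ⊎ card F < M
        conclude (inj₁ c) = inj₁ (common c)
        conclude (inj₂ (𝒲 , kernels , cov , few)) = inj₂ (begin-strict
          card F                 ≤⟨ count-covered 𝒲 (distinct F) (All.map proj₁ kernels) (covers-members cov) ⟩
          sum (map capW 𝒲)       ≤⟨ sum-const (All.map (λ { {W} (_ , l) → one W l }) kernels) ⟩
          length 𝒲 * 1           ≡⟨ *-identityʳ (length 𝒲) ⟩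
          length 𝒲               ≤⟨ few ⟩
          2 + t + t * 4          <⟨ m<m+n (2 + t + t * 4) {8} z<s ⟩
          2 + t + t * 4 + 8      ≡⟨ regroup t ⟩
          5 * (t + 2) * 1        ≡⟨ cong (λ x → 5 * x * 1) k≡ ⟨
          5 * k * 1              ≡⟨ cong (5 * k *_) one-block ⟨
          5 * k * stirling m 1   ≤⟨ stirling-ratio {5 * k} m 0 large ⟩
          M                      ∎)
          where
          open ≤-Reasoning
          regroup : ∀ t → 2 + t + t * 4 + 8 ≡ 5 * (t + 2) * 1
          regroup = solve-∀
          one : ∀ W → length W ≡ suc t → capW W ≤ 1
          one W l rewrite trans (cong (k ∸_) (trans l (+-comm 1 t))) (k∸[t+s] 1 1 refl) = stirling≤1 (n ∸ length W) ≤-refl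
          one-block : stirling m 1 ≡ 1
          one-block = positive m large
            where
            positive : ∀ m → suc (5 * k) ^ 1 ≤ 2 ^ m → stirling m 1 ≡ 1
            positive zero     le = contradiction le (<⇒≱ (≤-trans (s≤s 1≤5k) (≤-reflexive (sym (*-identityʳ (suc (5 * k)))))))
            positive (suc m′) _  = stirling-1 m′

      -- Here `small` is the bound M/(5k)^(s+1) for partitions with t + s + 1 given blocks. In the
      -- top layer whole partitions are given, g is 1, and `last` relies on `stirling-large`, which
      -- needs k ≥ t + 3.
      deep : ∀ p′ → p ≡ suc p′ → CommonBlocks ⊎ card F < M
      deep p′ refl = conclude (peel (2 + p) 𝒯 (≤-reflexive (sym k≡)) (sets (≤-reflexive k≡)))
        where
        g : ℕ → ℕ
        g s = cap (n ∸ (t + s)) (k ∸ (t + s))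
        open Peeling t k g
        open Budget t k g
        small : ∀ s → suc s ≤ suc p → (5 * k) ^ suc s * g (suc s) ≤ M
        small s le with stirling-ratios (suc s) (p ∸ s) m 1≤5k
          (subst (λ e → suc (5 * k) ^ suc e ≤ 2 ^ m) (sym (m+[n∸m]≡n (s≤s⁻¹ le))) large)
        ... | m′ , m≡ , _ , bound = subst₂ (λ x y → (5 * k) ^ suc s * x ≤ stirling (suc m) (2 + y))
          (sym (cong₂ cap (n∸[t+s] (suc s) m′ m≡)
            (k∸[t+s] (suc s) (suc (p ∸ s)) (trans (cong (2 +_) (sym (m+[n∸m]≡n (s≤s⁻¹ le)))) (cong suc (sym (+-suc s (p ∸ s))))))))
          (m+[n∸m]≡n (s≤s⁻¹ le)) bound
        last : (5 * k) ^ (2 + p) * g (2 + p) ≤ 2 * M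
        last = subst (λ x → (5 * k) ^ (2 + p) * cap (n ∸ (t + (2 + p))) x ≤ 2 * M) (sym (k∸[t+s] (2 + p) 0 (sym (+-identityʳ (2 + p)))))
          (≤-trans (≤-reflexive (*-identityʳ _)) (stirling-large p′ m 1≤5k large))
        conclude : _ → CommonBlocks ⊎ card F < M
        conclude (inj₁ c) = inj₁ (common c)
        conclude (inj₂ (𝒲 , kernels , cov , cheap)) = inj₂ (begin-strict
          card F                 ≤⟨ count-covered 𝒲 (distinct F) (All.map proj₁ kernels) (covers-members cov) ⟩
          sum (map capW 𝒲)       ≤⟨ sum-mono (All.map (λ { {W} (_ , l , _) → ≤-reflexive (cong₂ (λ x y → cap (n ∸ x) (k ∸ y)) (sym (m+[n∸m]≡n (<⇒≤ l))) (sym (m+[n∸m]≡n (<⇒≤ l)))) }) kernels) ⟩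
          cost 𝒲                 ≤⟨ cheap ⟩
          budget (2 + p)         <⟨ budget-< p (≤-reflexive (sym k≡)) M-positive small last ⟩
          M                      ∎)
          where open ≤-Reasoning

    common-or-small : CommonBlocks ⊎ card F < M
    common-or-small = by-codimension p refl
      where
      by-codimension : ∀ q → p ≡ q → CommonBlocks ⊎ card F < M
      by-codimension zero e = codimension-two e
      by-codimension (suc p′) e = deep p′ e

    private
      stirling-∁ : ∀ {X : List (Subset n)} → length X ≡ t → ∣ ∁ (⋃ X) ∣ ≡ suc m → stirling ∣ ∁ (⋃ X) ∣ (k ∸ length X) ≡ M
      stirling-∁ lX e = cong₂ stirling e (trans (cong (k ∸_) (trans lX (sym (+-identityʳ t)))) (k∸[t+s] 0 (2 + p) refl))

      n∸t≡ : n ∸ t ≡ suc m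
      n∸t≡ = trans (cong (n ∸_) (sym (+-identityʳ t))) (n∸[t+s] 0 m refl)

    -- The second alternative arises when the t common blocks are singletons.
    trivial-family : CommonBlocks → card F < M ⊎ (card F ≤ M × (card F ≡ M → FixesSingletons t F))
    trivial-family (X , uX , lX , sub) = by-members (members F) refl
      where
      by-members : ∀ L → members F ≡ L → card F < M ⊎ (card F ≤ M × (card F ≡ M → FixesSingletons t F))
      -- Only a member guarantees that X consists of disjoint nonempty blocks; the empty family is
      -- settled by M > 0.
      by-members [] e = inj₁ (subst (λ L → length L < M) (sym e) M-positive)
      by-members (P ∷ L) e = by-size (sum (map ∣_∣ X) ≤? t)
        where
        X⊆P : X ⊆ blocks P
        X⊆P = All.lookup sub (subst (P ∈_) (sym e) (here refl))
        ne = nonempty-⊆ P X⊆P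
        t≤ : t ≤ sum (map ∣_∣ X)
        t≤ = ≤-trans (≤-reflexive (sym lX)) (length≤sizes ne)
        bound = count-⊇ (distinct F) uX sub
        by-size : Dec (sum (map ∣_∣ X) ≤ t) → card F < M ⊎ (card F ≤ M × (card F ≡ M → FixesSingletons t F))
        -- More than t points are covered, so at most m of the n points remain.
        by-size (no ≰t) = inj₁ (begin-strict
          card F                                  ≤⟨ bound ⟩
          stirling ∣ ∁ (⋃ X) ∣ (k ∸ length X)     ≡⟨ cong₂ stirling (∣∁⋃∣ P uX X⊆P) (trans (cong (k ∸_) (trans lX (sym (+-identityʳ t)))) (k∸[t+s] 0 (2 + p) refl)) ⟩
          stirling (n ∸ sum (map ∣_∣ X)) (2 + p)  ≤⟨ stirling-mono (suc p) (∸-monoʳ-≤ n (≰⇒> ≰t)) ⟩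
          stirling (n ∸ suc t) (2 + p)            ≡⟨ cong (λ x → stirling x (2 + p)) (trans (cong (_∸ suc t) (trans n≡ (cong (_+ m) (+-comm t 1)))) (m+n∸m≡n (suc t) m)) ⟩
          stirling m (2 + p)                      <⟨ stirling-strict m p M-positive ⟩
          M                                       ∎)
          where open ≤-Reasoning
        -- The t blocks cover only t points, so they are the singletons of T = ⋃ X.
        by-size (yes ≤t) = inj₂ (≤-trans bound (≤-reflexive equals-M) , λ full → ⋃ X , ∣⋃X∣≡t , λ Q → mk⇔ (forward Q) (backward full Q))
          where
          size≡t = ≤-antisym ≤t t≤
          equals-M : stirling ∣ ∁ (⋃ X) ∣ (k ∸ length X) ≡ M
          equals-M = stirling-∁ {X} lX (trans (∣∁⋃∣ P uX X⊆P) (trans (cong (n ∸_) size≡t) n∸t≡))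
          ∣⋃X∣≡t : ∣ ⋃ X ∣ ≡ t
          ∣⋃X∣≡t = trans (∣⋃∣-disjoint (disjoint-⊆ uX X⊆P (proj₁ (proj₂ (proj₂ (proj₂ P)))))) size≡t
          tiny : All (λ b → ∣ b ∣ ≤ 1) X
          tiny = sizes≡length⇒1 ne (≤-trans ≤t (≤-reflexive (sym lX)))
          forward : ∀ Q → Q ∈ᶠ members F → ∀ x → x Sub.∈ ⋃ X → ⁅ x ⁆ ∈ blocks Q
          forward Q Q∈ x x∈ =
            let Q′ , Q′∈ , Q↭Q′ = find Q∈
                b , b∈ , x∈b = find (∈-⋃⁻ X x∈)
            in ↭.∈-resp-↭ (↭-sym Q↭Q′) (All.lookup sub Q′∈ (subst (_∈ X) (∣∣≤1⇒singleton (All.lookup tiny b∈) x∈b) b∈))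
          -- Equality makes the passage from members to partitions of the remaining points onto, so
          -- the rest of Q is also the rest of a member, which then agrees with Q up to order.
          backward : card F ≡ M → ∀ Q → (∀ x → x Sub.∈ ⋃ X → ⁅ x ⁆ ∈ blocks Q) → Q ∈ᶠ members F
          backward full Q all =
            let cs , cs∈ , Q↭ = find (residual (proj₂ Q) uX X⊆Q)
            in Any.map (λ Q′↭ → ↭-trans Q↭ (↭-sym Q′↭)) (All.lookup onto cs∈)
            where
            X⊆Q : X ⊆ blocks Q
            X⊆Q b∈ = let x , x∈b = All.lookup ne b∈ in
              subst (_∈ blocks Q) (sym (∣∣≤1⇒singleton (All.lookup tiny b∈) x∈b)) (all x (∈-⋃⁺ (lose b∈ x∈b)))
            onto = pigeonhole-onto {R = λ P cs → blocks P ↭ X ++ cs} (λ {P} {Q} → joinable {X} {P} {Q}) (distinct F) (hits uX sub)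
              (≤-reflexive (trans (length-partitions (∁ (⋃ X)) (k ∸ length X)) (trans equals-M (sym full))))

    -- Pigeonhole in both directions: every member restricts to a partition of the points outside T,
    -- and each such partition, with the singletons added, is a member.
    fixing-family : FixesSingletons t F → card F ≡ M
    fixing-family (T , ∣T∣≡t , fixes) = ≤-antisym
      (≤-trans (count-⊇ {W} (distinct F) uW contains) (≤-reflexive equals-M))
      (≤-trans (≤-reflexive (sym (trans (length-partitions (∁ (⋃ W)) (k ∸ length W)) equals-M)))
        (pigeonhole {R = λ cs P → W ++ cs ↭ blocks P} (λ p q ≉ → ≉ (++-cancelˡ-↭ W (↭-trans p (↭-sym q))))
          (partitions-distinct (∁ (⋃ W)) (k ∸ length W)) (All.map member (partitions-sound (∁ (⋃ W)) (k ∸ length W)))))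
      where
      W = singletons T
      W-partition = singletons-partition T
      uW = unique-blocks (proj₁ (proj₂ W-partition)) (proj₁ (proj₂ (proj₂ W-partition)))
      lW : length W ≡ t
      lW = trans (proj₁ W-partition) ∣T∣≡t
      equals-M : stirling ∣ ∁ (⋃ W) ∣ (k ∸ length W) ≡ M
      equals-M = stirling-∁ {W} lW (trans (cong (λ A → ∣ ∁ A ∣) (⋃-singletons T))
        (trans (Sub.∣∁p∣≡n∸∣p∣ T) (trans (cong (n ∸_) ∣T∣≡t) n∸t≡)))
      contains : All (λ P → W ⊆ blocks P) (members F)
      contains = All.tabulate λ {P} P∈ b∈ → let x , x∈ , e = ∈-singletons⁻ b∈ in
        subst (_∈ blocks P) (sym e) (Equivalence.to (fixes P) (∈⇒∈ᶠ P∈) x x∈)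
      member : ∀ {cs} → PartitionOf (∁ (⋃ W)) (k ∸ length W) cs → Any (λ P → W ++ cs ↭ blocks P) (members F)
      member {cs} C = Equivalence.from (fixes Q) λ x x∈ → ∈-++⁺ˡ (∈-singletons⁺ x∈)
        where
        Q : KPartition n k
        Q = W ++ cs , join (≤-trans (≤-reflexive lW) (≤-trans (m≤m+n t (2 + p)) (≤-reflexive (sym k≡))))
              (subst (λ l → PartitionOf (⋃ W) l W) (sym (proj₁ W-partition)) W-partition) C

    extremal : card F ≤ M × (card F ≡ M ⇔ FixesSingletons t F)
    extremal with common-or-small
    ... | inj₂ lt = <⇒≤ lt , mk⇔ (λ e → contradiction e (<⇒≢ lt)) fixing-family
    ... | inj₁ c with trivial-family c
    ... | inj₁ lt = <⇒≤ lt , mk⇔ (λ e → contradiction e (<⇒≢ lt)) fixing-family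
    ... | inj₂ (le , full) = le , mk⇔ full fixing-family

-- From the logarithmic hypothesis to the integer bound

theorem5p2 : ∀ (t k n : ℕ) → 1 ≤ t → t + 2 ≤ k →
    (F : Family n k) → Intersecting t F →
    fromℕ n ≥ℝ fromℕ (t + 1) +ℝ (k ∸ t ∸ 1) · log₂ ((2 * k) · e +ℝ fromℕ 1) →
    card F ≤ S (n ∸ t) (k ∸ t) ×
    (card F ≡ S (n ∸ t) (k ∸ t) ⇔ FixesSingletons t F)
theorem5p2 t k n 1≤t t+2≤k F int n≥ =
  let p = k ∸ (t + 2)
      k≡ : k ≡ t + (2 + p)
      k≡ = trans (sym (m+[n∸m]≡n t+2≤k)) (+-assoc t 2 p)
      k∸t≡ : k ∸ t ≡ 2 + p
      k∸t≡ = trans (cong (_∸ t) k≡) (m+n∸m≡n t (2 + p))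
      3≤k : 3 ≤ k
      3≤k = ≤-trans (+-monoˡ-≤ 2 1≤t) t+2≤k
      -- As 2e > 5, the integer 5k + 1 lies below 2ek + 1, which permits r = 5k; the exponent p + 1
      -- is k - t - 1.
      m , n≡ , large = Cuts.integral-bound {n} {t + 1} {r = 5 * k} p
        (subst (λ x → fromℕ n ≥ℝ fromℕ (t + 1) +ℝ (x ∸ 1) · log₂ ((2 * k) · e +ℝ fromℕ 1)) k∸t≡ n≥)
        (Cuts.5k+1-cut k 3≤k) (≤-trans (≤-trans (n≤1+n 2) 3≤k) (m≤n*m k 5))
      n∸t≡ : n ∸ t ≡ suc m
      n∸t≡ = trans (cong (_∸ t) (trans n≡ (+-assoc t 1 m))) (m+n∸m≡n t (suc m))
      S≡ : S (n ∸ t) (k ∸ t) ≡ stirling (suc m) (2 + p)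
      S≡ = trans (S≡stirling (n ∸ t) (k ∸ t)) (cong₂ stirling n∸t≡ k∸t≡)
  in subst (λ M → card F ≤ M × (card F ≡ M ⇔ FixesSingletons t F)) (sym S≡) (extremal n≡ k≡ large F int)
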